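{- Let $k \geq 2$ and let $G = (\{a,b\}, \varphi, a)$ be a circular D0L-system in which the morphism $\varphi$ is $k$-uniform. Let $d$ denote the least divisor of $k$ greater than $1$. Then the minimal synchronizing delay $Z_{\min}$ of $G$ satisfies: (i) $Z_{\min} \leq 8$ if $k = 2$; (ii) $Z_{\min} \leq k^2 + 3k - 4$ if $k$ is an odd prime; (iii) $Z_{\min} \leq k^2\left(\frac{k}{d} - 1\right) + 5k - 4$ otherwise.
   Context: A D0L-system is a triple $G=(\mathcal{A},\varphi,w)$ with $\mathcal{A}$ a finite alphabet, $\varphi:\mathcal{A}^*\to\mathcal{A}^*$ a morphism and $w\in\mathcal{A}^+$ (the axiom). Its language is $L(G)=\{\varphi^n(w): n\in\mathbb{N}\}$ and $S(L(G))$ is the set of all factors of words of $L(G)$; the alphabet is assumed minimal, i.e. every letter of $\mathcal{A}$ belongs to $S(L(G))$. $G$ is a PD0L-system if $\varphi(c)\neq\varepsilon$ for all $c\in\mathcal{A}$. $G$ is injective on $S(L(G))$ if $\varphi(u)=\varphi(v)$ with $u,v\in S(L(G))$ implies $u=v$. For $u\in S(L(G))$, an interpretation of $u$ is a triple $(p,v,s)$ with $p,s\in\mathcal{A}^*$, $v\in S(L(G))$ and $\varphi(v)=pus$. Writing $v=v_1\cdots v_n$, $v'=v'_1\cdots v'_m$, $u=u_1\cdots u_\ell$ (letters), two interpretations $(p,v,s)$, $(p',v',s')$ of $u$ are synchronized at position $j$ ($0\le j\le \ell$) if there are indices $i,i'$ with $\varphi(v_1\cdots v_i)=p\,u_1\cdots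 u_j$ and $\varphi(v'_1\cdots v'_{i'})=p'\,u_1\cdots u_j$ (empty products are $\varepsilon$). The word $u$ has a synchronizing point at position $j$ if all its interpretations are pairwise synchronized at position $j$. A PD0L-system injective on $S(L(G))$ is circular if there is a positive integer $Z$ (a synchronizing delay) such that every $u\in S(L(G))$ with $|u|>Z$ has a synchronizing point; $Z_{\min}$ denotes the least such $Z$. A morphism $\varphi$ on $\{a,b\}$ is $k$-uniform if $|\varphi(a)|=|\varphi(b)|=k$. -}

module Defs where

open import Data.Fin using (Fin; zero; suc)
open import Data.List using (List; []; [_]; _++_; length; take; concatMap)
open import Data.List.Relation.Binary.Infix.Heterogeneous using (Infix)
open import Data.Nat using (ℕ; _≤_; _<_; _>_)
open import Data.Nat.Divisibility using (_∣_; _∤_)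
open import Data.Nat.GeneralisedArithmetic using (fold)
open import Data.Nat.Primality using (Prime)
open import Data.Product using (_×_; ∃-syntax)
open import Relation.Binary.PropositionalEquality using (_≡_; _≢_)

IsLeast : (ℕ → Set) → ℕ → Set
IsLeast P m = P m × (∀ n → P n → m ≤ n)

IsLeastDivisor>1 : ℕ → ℕ → Set
IsLeastDivisor>1 k = IsLeast (λ d → 1 < d × d ∣ k)

OddPrime : ℕ → Set
OddPrime k = Prime k × 2 ∤ k

Word : ℕ → Set
Word n = List (Fin n)

-- The morphism Fin n* → Fin n* determined by the images of the letters.
extend : ∀ {n} → (Fin n → Word n) → Word n → Word n
extend = concatMap

-- u is a factor (contiguous subword) of φʲ(w) for some j, that is, u ∈ S(L(G)).
FactorOfLanguage : ∀ {n} → (Fin n → Word n) → Word n → Word n → Set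
FactorOfLanguage φ w u = ∃[ j ] Infix _≡_ u (fold w (extend φ) j)

-- A D0L-system over an n-letter alphabet.
record D0L (n : ℕ) : Set where
  field
    image         : Fin n → Word n
    axiomWord     : Word n
    axiomNonEmpty : axiomWord ≢ []
    -- The alphabet is minimal.
    lettersOccur  : ∀ c → FactorOfLanguage image axiomWord [ c ]

  φ : Word n → Word n
  φ = extend image

  _∈S : Word n → Set
  u ∈S = FactorOfLanguage image axiomWord u

open D0L public using (axiomWord)

module _ {n : ℕ} (G : D0L n) where
  open D0L G

  IsPD0L : Set
  IsPD0L = ∀ c → image c ≢ []

  InjectiveOnFactors : Set
  InjectiveOnFactors = ∀ u v → u ∈S → v ∈S → φ u ≡ φ v → u ≡ v

  Uniform : ℕ → Set
  Uniform k = ∀ c → length (image c) ≡ k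

  record Interpretation (u : Word n) : Set where
    field
      p v s  : Word n
      v∈S    : v ∈S
      φv≡pus : φ v ≡ p ++ u ++ s

  SynchronizedAt : ∀ {u} → ℕ → Interpretation u → Interpretation u → Set
  SynchronizedAt {u} j I I′ =
    ∃[ i ] ∃[ i′ ] i ≤ length I.v × i′ ≤ length I′.v
      × φ (take i I.v) ≡ I.p ++ take j u
      × φ (take i′ I′.v) ≡ I′.p ++ take j u
    where
      module I = Interpretation I
      module I′ = Interpretation I′

  HasSynchronizingPoint : Word n → Set
  HasSynchronizingPoint u =
    ∃[ j ] j ≤ length u × ((I I′ : Interpretation u) → SynchronizedAt j I I′)

  IsSynchronizingDelay : ℕ → Set
  IsSynchronizingDelay Z =
    1 ≤ Z × (∀ u → u ∈S → length u > Z → HasSynchronizingPoint u)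

  IsMinimalSynchronizingDelay : ℕ → Set
  IsMinimalSynchronizingDelay = IsLeast IsSynchronizingDelay

  record Circular : Set where
    field
      isPD0L    : IsPD0L
      injective : InjectiveOnFactors
      delay     : ∃[ Z ] IsSynchronizingDelay Z

-- The binary alphabet {a, b}.
pattern a = zero
pattern b = suc zero

{-# OPTIONS --safe #-}
module Submission where

-- A word of length at least k without a synchronizing point has two interpretations whose block
-- boundaries differ modulo k, so the images of two words v, w of S(L(G)), with about |u| / k
-- letters each, overlap with a shift 0 < h < k (an Overhang).  As there are two letters only, a
-- long overhang is rigid: either v is essentially x^n and w is y^n, or v and w alternate.
-- If x ≠ y, then φ(x) and φ(y) are conjugate, and the runs x^n, y^n are both long only if the
-- k letters of φ(x) contain more than k/2 letters x and more than k/2 letters y.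
-- If x = y, then φ(x) is a proper power with a period g dividing k, and if v alternates, then
-- φ(xy) has a period g < k dividing 2k.  In both cases the images are so restricted that a longer
-- overhang in S(L(G)) generates arbitrarily long ones, which circularity forbids.
-- Words are handled as functions on ℕ restricted to an initial segment, and 𝒮 f n says that
-- f 0 ⋯ f (n - 1) is a factor of the language.

open import Defs
open import Data.Empty using (⊥)
open import Data.Fin using (Fin; zero; suc) renaming (_≟_ to _≟ᶠ_)
open import Data.List using (List; []; _∷_; [_]; _++_; length; take; drop; applyUpTo)
open import Data.List.Properties using (++-assoc; ++-identityʳ; length-++; length-applyUpTo; concatMap-++; take++drop≡id;
  ∷-injective; length-take)
open import Data.List.Relation.Binary.Infix.Heterogeneous using (Infix; MkView; toView; fromView)
open import Data.List.Relation.Binary.Infix.Heterogeneous.Properties using (length-mono) renaming (trans to infix-trans)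
open import Data.List.Relation.Binary.Pointwise using (Pointwise-≡⇒≡; ≡⇒Pointwise-≡)
open import Data.Nat
open import Data.Nat.Divisibility
open import Data.Nat.DivMod
open import Data.Nat.GeneralisedArithmetic using (fold)
open import Data.Nat.GCD using (gcd; gcd[m,n]∣m; gcd[m,n]∣n; gcd[m,n]≡0⇒m≡0;
  gcd-GCD; module Bézout)
open import Data.Nat.Primality using (Prime; prime[2]; prime⇒irreducible; irreducible⇒prime;
  irreducible[2]; euclidsLemma)
open import Data.Nat.Properties
open import Data.Nat.Tactic.RingSolver using (solve-∀)
open import Data.Product using (_×_; _,_; proj₁; proj₂; ∃-syntax; Σ-syntax)
open import Data.Sum using (_⊎_; inj₁; inj₂)
open import Function using (_∘_; const; case_of_)
open import Relation.Binary.PropositionalEquality hiding ([_])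
open import Relation.Nullary using (¬_; Dec; yes; no; contradiction)

-- Words as lists and as functions on initial segments.

≤-of-+≡ : ∀ {m n} o → m + o ≡ n → m ≤ n
≤-of-+≡ {m} o refl = m≤m+n m o

module _ {A : Set} where

  applyUpTo-cong : ∀ {f g : ℕ → A} n → (∀ i → i < n → f i ≡ g i) → applyUpTo f n ≡ applyUpTo g n
  applyUpTo-cong zero    eq = refl
  applyUpTo-cong (suc n) eq =
    cong₂ _∷_ (eq 0 z<s) (applyUpTo-cong n (λ i i<n → eq (suc i) (s≤s i<n)))

  applyUpTo-+ : ∀ (f : ℕ → A) m n → applyUpTo f (m + n) ≡ applyUpTo f m ++ applyUpTo (f ∘ (m +_)) n
  applyUpTo-+ f zero    n = refl
  applyUpTo-+ f (suc m) n = cong (f 0 ∷_) (applyUpTo-+ (f ∘ suc) m n)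

  ++-cancel-length : ∀ (xs ys : List A) {us vs} → length xs ≡ length ys →
                     xs ++ us ≡ ys ++ vs → xs ≡ ys × us ≡ vs
  ++-cancel-length []       []       _   eq   = refl , eq
  ++-cancel-length (x ∷ xs) (y ∷ ys) len eq
    with refl , eq′ ← ∷-injective eq
    with refl , us≡vs ← ++-cancel-length xs ys (suc-injective len) eq′ = refl , us≡vs

  infix⇒++ : ∀ {u w : List A} → Infix _≡_ u w → ∃[ p ] ∃[ s ] w ≡ p ++ u ++ s
  infix⇒++ inf with toView inf
  ... | MkView p eq s with refl ← Pointwise-≡⇒≡ eq = p , s , refl

  ++⇒infix : ∀ p (u : List A) s → Infix _≡_ u (p ++ u ++ s)
  ++⇒infix p u s = fromView (MkView p (≡⇒Pointwise-≡ refl) s)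

-- The letter `a` past the end is a placeholder that makes the function total.
nth : Word 2 → ℕ → Fin 2
nth []      _       = a
nth (c ∷ _) zero    = c
nth (_ ∷ w) (suc i) = nth w i

applyUpTo-nth : ∀ w → applyUpTo (nth w) (length w) ≡ w
applyUpTo-nth []      = refl
applyUpTo-nth (c ∷ w) = cong (c ∷_) (applyUpTo-nth w)

nth-++ʳ : ∀ p w i → nth (p ++ w) (length p + i) ≡ nth w i
nth-++ʳ []      w i = refl
nth-++ʳ (c ∷ p) w i = nth-++ʳ p w i

nth-++ˡ : ∀ u w i → i < length u → nth (u ++ w) i ≡ nth u i
nth-++ˡ (c ∷ u) w zero    i<          = refl
nth-++ˡ (c ∷ u) w (suc i) (s≤s i<) = nth-++ˡ u w i i<

nth-applyUpTo : ∀ f n i → i < n → nth (applyUpTo f n) i ≡ f i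
nth-applyUpTo f (suc n) zero    i<       = refl
nth-applyUpTo f (suc n) (suc i) (s≤s i<) = nth-applyUpTo (f ∘ suc) n i i<

-- Periodic infinite words.

Periodic : (ℕ → Fin 2) → ℕ → Set
Periodic f p = ∀ n → f (p + n) ≡ f n

periodic-* : ∀ {f p} → Periodic f p → ∀ x n → f (x * p + n) ≡ f n
periodic-*         per zero    n = refl
periodic-* {f} {p} per (suc x) n =
  trans (cong f (+-assoc p (x * p) n)) (trans (per _) (periodic-* per x n))

-- By Bézout the gcd is a difference of multiples of p and q. The words are infinite, so no length
-- condition as in the theorem of Fine and Wilf arises.
periodic-gcd : ∀ {f p q} → Periodic f p → Periodic f q → Periodic f (gcd p q)
periodic-gcd {f} {p} {q} per-p per-q n with Bézout.identity (gcd-GCD p q)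
... | Bézout.+- x y eq = begin
  f (gcd p q + n)              ≡⟨ sym (periodic-* per-q y _) ⟩
  f (y * q + (gcd p q + n))    ≡⟨ cong f (rearrange (y * q) (gcd p q) n) ⟩
  f (gcd p q + y * q + n)      ≡⟨ cong (λ m → f (m + n)) eq ⟩
  f (x * p + n)                ≡⟨ periodic-* per-p x n ⟩
  f n                          ∎
  where
  open ≡-Reasoning
  rearrange : ∀ x y z → x + (y + z) ≡ y + x + z
  rearrange = solve-∀
... | Bézout.-+ x y eq = begin
  f (gcd p q + n)              ≡⟨ sym (periodic-* per-p x _) ⟩
  f (x * p + (gcd p q + n))    ≡⟨ cong f (rearrange (x * p) (gcd p q) n) ⟩
  f (gcd p q + x * p + n)      ≡⟨ cong (λ m → f (m + n)) eq ⟩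
  f (y * q + n)                ≡⟨ periodic-* per-q y n ⟩
  f n                          ∎
  where
  open ≡-Reasoning
  rearrange : ∀ x y z → x + (y + z) ≡ y + x + z
  rearrange = solve-∀

-- Every n is congruent modulo g to a position of the window of length g at r. The extra shift z
-- lets neighbouring letters be compared as well.
periodic-window : ∀ {f g} → Periodic f g → 0 < g → ∀ r n →
  ∃[ i ] i < g × (∀ z → f (z + n) ≡ f (z + (r + i)))
periodic-window {f} {g@(suc _)} per _ r n
  -- Adding r g keeps the residue and brings the position to r or beyond.
  with e , r+e≡ ← m≤n⇒∃[o]m+o≡n (≤-trans (m≤m*n r g) (m≤n+m (r * g) n)) =
  e % g , m%n<n e g , λ z → begin
    f (z + n)                              ≡⟨ sym (periodic-* per r (z + n)) ⟩
    f (r * g + (z + n))                    ≡⟨ cong f (shuffle z n r g) ⟩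
    f (z + (n + r * g))                    ≡⟨ cong (λ m → f (z + m)) (sym r+e≡) ⟩
    f (z + (r + e))                        ≡⟨ cong (λ m → f (z + (r + m))) (m≡m%n+[m/n]*n e g) ⟩
    f (z + (r + (e % g + e / g * g)))      ≡⟨ cong f (shuffle′ z r (e % g) _) ⟩
    f (e / g * g + (z + (r + e % g)))      ≡⟨ periodic-* per (e / g) _ ⟩
    f (z + (r + e % g))                    ∎
  where
  open ≡-Reasoning
  shuffle : ∀ z n r g → r * g + (z + n) ≡ z + (n + r * g)
  shuffle = solve-∀
  shuffle′ : ∀ z r x y → z + (r + (x + y)) ≡ y + (z + (r + x))
  shuffle′ = solve-∀

-- The two letters: complement, alternation and counting.

other : Fin 2 → Fin 2
other a = b
other b = a

other-involutive : ∀ c → other (other c) ≡ c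
other-involutive a = refl
other-involutive b = refl

other≢ : ∀ c → other c ≢ c
other≢ a ()
other≢ b ()

≢⇒≡other : ∀ {c d} → c ≢ d → d ≡ other c
≢⇒≡other {a} {a} c≢d = contradiction refl c≢d
≢⇒≡other {a} {b} c≢d = refl
≢⇒≡other {b} {a} c≢d = refl
≢⇒≡other {b} {b} c≢d = contradiction refl c≢d

≢-covers : ∀ {c d : Fin 2} → c ≢ d → ∀ e → e ≡ c ⊎ e ≡ d
≢-covers {c} c≢d e with e ≟ᶠ c
... | yes e≡c = inj₁ e≡c
... | no  e≢c = inj₂ (trans (≢⇒≡other (e≢c ∘ sym)) (sym (≢⇒≡other c≢d)))

alt : Fin 2 → ℕ → Fin 2
alt c zero    = c
alt c (suc n) = alt (other c) n

alt-suc : ∀ c n → alt c (suc n) ≡ other (alt c n)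
alt-suc c zero    = refl
alt-suc c (suc n) = alt-suc (other c) n

alternates⇒alt : ∀ (f : ℕ → Fin 2) n → (∀ i → suc i < n → f i ≢ f (suc i)) → ∀ i → i < n → f i ≡ alt (f 0) i
alternates⇒alt f n alternates zero    _ = refl
alternates⇒alt f n alternates (suc i) i<n = begin
  f (suc i)          ≡⟨ ≢⇒≡other (alternates i i<n) ⟩
  other (f i)        ≡⟨ cong other (alternates⇒alt f n alternates i (<-trans (n<1+n i) i<n)) ⟩
  other (alt (f 0) i) ≡⟨ sym (alt-suc (f 0) i) ⟩
  alt (f 0) (suc i)  ∎
  where open ≡-Reasoning

hit : Fin 2 → Fin 2 → ℕ
hit a a = 1
hit a b = 0
hit b a = 0
hit b b = 1

hit-refl : ∀ z → hit z z ≡ 1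
hit-refl a = refl
hit-refl b = refl

hit-other : ∀ z c → hit z c + hit (other z) c ≡ 1
hit-other a a = refl
hit-other a b = refl
hit-other b a = refl
hit-other b b = refl

count : Fin 2 → (ℕ → Fin 2) → ℕ → ℕ
count z f zero    = 0
count z f (suc n) = hit z (f 0) + count z (f ∘ suc) n

count-cong : ∀ z {f g} n → (∀ i → i < n → f i ≡ g i) → count z f n ≡ count z g n
count-cong z zero    eq = refl
count-cong z (suc n) eq =
  cong₂ _+_ (cong (hit z) (eq 0 z<s)) (count-cong z n (λ i i<n → eq (suc i) (s≤s i<n)))

count-+ : ∀ z f m n → count z f (m + n) ≡ count z f m + count z (f ∘ (m +_)) n
count-+ z f zero    n = refl
count-+ z f (suc m) n =
  trans (cong (hit z (f 0) +_) (count-+ z (f ∘ suc) m n)) (sym (+-assoc (hit z (f 0)) _ _))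

count-const : ∀ z {f} n → (∀ i → i < n → f i ≡ z) → count z f n ≡ n
count-const z {f} zero    eq = refl
count-const z {f} (suc n) eq = cong₂ _+_ (trans (cong (hit z) (eq 0 z<s)) (hit-refl z))
  (count-const z n (λ i i<n → eq (suc i) (s≤s i<n)))

count-other : ∀ z f n → count z f n + count (other z) f n ≡ n
count-other z f zero    = refl
count-other z f (suc n) = trans (exchange (hit z (f 0)) _ (hit (other z) (f 0)) _)
  (cong₂ _+_ (hit-other z (f 0)) (count-other z (f ∘ suc) n))
  where
  exchange : ∀ x y z w → x + y + (z + w) ≡ x + z + (y + w)
  exchange = solve-∀

-- The uniform morphism on infinite words.

module System (k : ℕ) (2≤k : 2 ≤ k) .{{_ : NonZero k}} (G : D0L 2) (axiom≡a : axiomWord G ≡ [ a ])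
              (uniform : Uniform G k) where

  open D0L G hiding (axiomWord)

  0<k : 0 < k
  0<k = ≤-trans (s≤s z≤n) 2≤k

  img : Fin 2 → ℕ → Fin 2
  img c = nth (image c)

  -- The extension of φ to infinite words; by uniformity position n lies in block `n / k` at offset
  -- `n % k`.
  Φ : (ℕ → Fin 2) → ℕ → Fin 2
  Φ f n = img (f (n / k)) (n % k)

  block-/ : ∀ q {i} → i < k → (q * k + i) / k ≡ q
  block-/ q {i} i<k = begin
    (q * k + i) / k     ≡⟨ +-distrib-/-∣ˡ i (n∣m*n q) ⟩
    q * k / k + i / k   ≡⟨ cong₂ _+_ (m*n/n≡m q k) (m<n⇒m/n≡0 i<k) ⟩
    q + 0               ≡⟨ +-identityʳ q ⟩
    q                   ∎
    where open ≡-Reasoning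

  Φ-block : ∀ f q {i} → i < k → Φ f (q * k + i) ≡ img (f q) i
  Φ-block f q {i} i<k = cong₂ (λ x y → img (f x) y) (block-/ q i<k)
    (trans (trans (cong (_% k) (+-comm (q * k) i)) ([m+kn]%n≡m%n i q k)) (m<n⇒m%n≡m i<k))

  Φ-head : ∀ f {i} → i < k → Φ f i ≡ img (f 0) i
  Φ-head f i<k = Φ-block f 0 i<k

  divide : ∀ n → ∃[ q ] ∃[ i ] i < k × n ≡ q * k + i
  divide n = n / k , n % k , m%n<n n k , trans (m≡m%n+[m/n]*n n k) (+-comm (n % k) _)

  Φ-+ : ∀ f q n → Φ f (q * k + n) ≡ Φ (f ∘ (q +_)) n
  Φ-+ f q n with t , i , i<k , refl ← divide n = begin
    Φ f (q * k + (t * k + i))    ≡⟨ cong (Φ f) (sym (+-assoc (q * k) (t * k) i)) ⟩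
    Φ f (q * k + t * k + i)      ≡⟨ cong (λ m → Φ f (m + i)) (sym (*-distribʳ-+ k q t)) ⟩
    Φ f ((q + t) * k + i)        ≡⟨ Φ-block f (q + t) i<k ⟩
    img (f (q + t)) i            ≡⟨ sym (Φ-block (f ∘ (q +_)) t i<k) ⟩
    Φ (f ∘ (q +_)) (t * k + i)   ∎
    where open ≡-Reasoning

  Φ-suc : ∀ f n → Φ f (k + n) ≡ Φ (f ∘ suc) n
  Φ-suc f n = trans (cong (λ m → Φ f (m + n)) (sym (*-identityˡ k))) (Φ-+ f 1 n)

  Φ-cong : ∀ {f g} → (∀ i → f i ≡ g i) → ∀ n → Φ f n ≡ Φ g n
  Φ-cong eq n = cong (λ c → img c (n % k)) (eq (n / k))

  φ-applyUpTo : ∀ f n → φ (applyUpTo f n) ≡ applyUpTo (Φ f) (n * k)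
  φ-applyUpTo f zero    = refl
  φ-applyUpTo f (suc n) = begin
    image (f 0) ++ φ (applyUpTo (f ∘ suc) n)
      ≡⟨ cong₂ _++_ image-f0 (φ-applyUpTo (f ∘ suc) n) ⟩
    applyUpTo (Φ f) k ++ applyUpTo (Φ (f ∘ suc)) (n * k)
      ≡⟨ cong (applyUpTo (Φ f) k ++_) (applyUpTo-cong (n * k) (λ i _ → sym (Φ-suc f i))) ⟩
    applyUpTo (Φ f) k ++ applyUpTo (Φ f ∘ (k +_)) (n * k)
      ≡⟨ sym (applyUpTo-+ (Φ f) k (n * k)) ⟩
    applyUpTo (Φ f) (k + n * k) ∎
    where
    open ≡-Reasoning
    image-f0 : image (f 0) ≡ applyUpTo (Φ f) k
    image-f0 = begin
      image (f 0)                                ≡⟨ sym (applyUpTo-nth _) ⟩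
      applyUpTo (img (f 0)) (length (image (f 0))) ≡⟨ cong (applyUpTo (img (f 0))) (uniform (f 0)) ⟩
      applyUpTo (img (f 0)) k                    ≡⟨ applyUpTo-cong k (λ i i<k → sym (Φ-head f i<k)) ⟩
      applyUpTo (Φ f) k                          ∎

  φ-nth : ∀ w → φ w ≡ applyUpTo (Φ (nth w)) (length w * k)
  φ-nth w = trans (cong φ (sym (applyUpTo-nth w))) (φ-applyUpTo (nth w) (length w))

  length-φ : ∀ w → length (φ w) ≡ length w * k
  length-φ w = trans (cong length (φ-nth w)) (length-applyUpTo (Φ (nth w)) (length w * k))

  -- Factors of the language and their desubstitution.

  infix⇒∈S : ∀ {u w} → Infix _≡_ u w → w ∈S → u ∈S
  infix⇒∈S u⊑w (j , w⊑) = j , infix-trans trans u⊑w w⊑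

  ∈S⇒φ∈S : ∀ {u} → u ∈S → φ u ∈S
  ∈S⇒φ∈S {u} (j , u⊑) with p , s , eq ← infix⇒++ u⊑ =
    suc j , subst (Infix _≡_ (φ u)) (sym (trans (cong φ eq) φ-pus)) (++⇒infix (φ p) (φ u) (φ s))
    where
    φ-pus : φ (p ++ u ++ s) ≡ φ p ++ φ u ++ φ s
    φ-pus = trans (concatMap-++ image p (u ++ s)) (cong (φ p ++_) (concatMap-++ image u s))

  -- A word of two or more letters is no factor of the axiom, which is a single letter, so it occurs
  -- in the image of some iterate.
  interpretation : ∀ {u} → u ∈S → 2 ≤ length u → Interpretation G u
  interpretation (zero , u⊑) 2≤ =
    contradiction (≤-trans 2≤ (≤-trans (length-mono u⊑) (≤-reflexive (cong length axiom≡a)))) λ { (s≤s ()) }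
  interpretation (suc j , u⊑) 2≤ with p , s , eq ← infix⇒++ u⊑ =
    record { p = p ; v = fold (D0L.axiomWord G) φ j ; s = s ; v∈S = j , whole ; φv≡pus = eq }
    where
    whole : ∀ {w : Word 2} → Infix _≡_ w w
    whole {w} = subst (Infix _≡_ w) (++-identityʳ w) (++⇒infix [] w [])

  𝒮 : (ℕ → Fin 2) → ℕ → Set
  𝒮 f n = applyUpTo f n ∈S

  𝒮-cong : ∀ {f g n} → (∀ i → i < n → f i ≡ g i) → 𝒮 f n → 𝒮 g n
  𝒮-cong {n = n} eq = subst _∈S (applyUpTo-cong n eq)

  𝒮-factor : ∀ {f n} s m → s + m ≤ n → 𝒮 f n → 𝒮 (f ∘ (s +_)) m
  𝒮-factor {f} {n} s m le f∈ with o , refl ← m≤n⇒∃[o]m+o≡n le =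
    infix⇒∈S (subst (Infix _≡_ _) (sym split) (++⇒infix (applyUpTo f s) _ _)) f∈
    where
    split : applyUpTo f (s + m + o) ≡
            applyUpTo f s ++ applyUpTo (f ∘ (s +_)) m ++ applyUpTo (f ∘ (s +_) ∘ (m +_)) o
    split = trans (cong (applyUpTo f) (+-assoc s m o))
      (trans (applyUpTo-+ f s (m + o)) (cong (applyUpTo f s ++_) (applyUpTo-+ (f ∘ (s +_)) m o)))

  𝒮-prefix : ∀ {f n} m → m ≤ n → 𝒮 f n → 𝒮 f m
  𝒮-prefix m = 𝒮-factor 0 m

  𝒮-Φ : ∀ {f n} → 𝒮 f n → 𝒮 (Φ f) (n * k)
  𝒮-Φ {f} {n} f∈ = subst _∈S (φ-applyUpTo f n) (∈S⇒φ∈S f∈)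

  𝒮-letter : ∀ c n → n ≤ 1 → 𝒮 (const c) n
  𝒮-letter c n n≤1 = 𝒮-prefix n n≤1 (lettersOccur c)

  -- f is read off the image of g at the positions r, r + 1, …, r + n - 1.
  record Desubstitution (f : ℕ → Fin 2) (n : ℕ) : Set where
    field
      g       : ℕ → Fin 2
      m r     : ℕ
      r<k     : r < k
      fits    : r + n ≤ m * k
      g∈S     : 𝒮 g m
      reads   : ∀ i → i < n → Φ g (r + i) ≡ f i

  -- Dropping the blocks of φ(v) that end within p leaves an offset below k. The equation ties this
  -- offset to the interpretation, since phases are what is compared later.
  reduce : ∀ {u} (I : Interpretation G u) →
           Σ[ D ∈ Desubstitution (nth u) (length u) ] Desubstitution.r D ≡ length (Interpretation.p I) % k
  reduce {u} I = record
    { g = nth v ∘ (q +_) ; m = length v ∸ q ; r = length p % k ; r<k = m%n<n (length p) k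
    ; fits = fits′
    ; g∈S = 𝒮-factor q (length v ∸ q) (≤-reflexive (m+[n∸m]≡n q≤v)) (subst _∈S (sym (applyUpTo-nth v)) v∈S)
    ; reads = reads′ } , refl
    where
    open Interpretation I
    q = length p / k
    p≡ : length p ≡ q * k + length p % k
    p≡ = trans (m≡m%n+[m/n]*n (length p) k) (+-comm (length p % k) _)
    total : length p + (length u + length s) ≡ length v * k
    total = trans (sym (trans (length-++ p) (cong (length p +_) (length-++ u))))
                  (trans (cong length (sym φv≡pus)) (length-φ v))
    q≤v : q ≤ length v
    q≤v = *-cancelʳ-≤ q (length v) k (≤-trans (≤-of-+≡ _ (sym p≡)) (≤-of-+≡ _ total))
    fits′ : length p % k + length u ≤ (length v ∸ q) * k
    fits′ = +-cancelˡ-≤ (q * k) _ _ (≤-of-+≡ (length s) (begin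
      q * k + (length p % k + length u) + length s   ≡⟨ rearrange (q * k) (length p % k) (length u) (length s) ⟩
      q * k + length p % k + (length u + length s)   ≡⟨ cong (_+ (length u + length s)) (sym p≡) ⟩
      length p + (length u + length s)               ≡⟨ total ⟩
      length v * k                                   ≡⟨ cong (_* k) (sym (m+[n∸m]≡n q≤v)) ⟩
      (q + (length v ∸ q)) * k                       ≡⟨ *-distribʳ-+ k q _ ⟩
      q * k + (length v ∸ q) * k                     ∎))
      where
      open ≡-Reasoning
      rearrange : ∀ x y z w → x + (y + z) + w ≡ x + y + (z + w)
      rearrange = solve-∀
    reads′ : ∀ i → i < length u → Φ (nth v ∘ (q +_)) (length p % k + i) ≡ nth u i
    reads′ i i<u = begin
      Φ (nth v ∘ (q +_)) (length p % k + i)      ≡⟨ sym (Φ-+ (nth v) q _) ⟩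
      Φ (nth v) (q * k + (length p % k + i))     ≡⟨ cong (Φ (nth v)) (trans (sym (+-assoc (q * k) _ i)) (cong (_+ i) (sym p≡))) ⟩
      Φ (nth v) (length p + i)                   ≡⟨ sym (nth-applyUpTo (Φ (nth v)) (length v * k) _ p+i<) ⟩
      nth (applyUpTo (Φ (nth v)) (length v * k)) (length p + i) ≡⟨ cong (λ w → nth w (length p + i)) (trans (sym (φ-nth v)) φv≡pus) ⟩
      nth (p ++ u ++ s) (length p + i)           ≡⟨ nth-++ʳ p (u ++ s) i ⟩
      nth (u ++ s) i                             ≡⟨ nth-++ˡ u s i i<u ⟩
      nth u i                                    ∎
      where
      open ≡-Reasoning
      p+i< : length p + i < length v * k
      p+i< = <-≤-trans (+-monoʳ-< (length p) (<-≤-trans i<u (m≤m+n _ _))) (≤-reflexive total)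

  desubstitute : ∀ {f n} → 2 ≤ n → 𝒮 f n → Desubstitution f n
  desubstitute {f} {n} 2≤n f∈ = record
    { g = D.g ; m = D.m ; r = D.r ; r<k = D.r<k ; g∈S = D.g∈S
    ; fits  = subst (λ l → D.r + l ≤ D.m * k) len D.fits
    ; reads = λ i i<n → trans (D.reads i (subst (i <_) (sym len) i<n)) (nth-applyUpTo f n i i<n) }
    where
    len = length-applyUpTo f n
    module D = Desubstitution (proj₁ (reduce (interpretation f∈ (subst (2 ≤_) (sym len) 2≤n))))

  -- Overhangs versus synchronizing points.

  Long : ℕ → Set
  -- The 2k letters guarantee a full block, and k (g - 1) + 4 is what `run-bound` needs for a period
  -- g of the image. For prime k the only such period is 1, and k + 2 letters suffice.
  Long T = Prime k × 2 + k ≤ T ⊎ 2 * k ≤ T × (∀ {g} → g ∣ k → g < k → k * (g ∸ 1) + 4 ≤ T)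

  -- Blocks of φ(v) and φ(w) interleave: φ(w), shifted by h letters, agrees with φ(v)
  -- on the T k - h letters where both are defined.
  record Overhang (T : ℕ) : Set where
    field
      h       : ℕ
      v w     : ℕ → Fin 2
      0<h     : 0 < h
      h<k     : h < k
      v∈S     : 𝒮 v T
      w∈S     : 𝒮 w T
      agree : ∀ n → h + n < T * k → Φ v (h + n) ≡ Φ w n

  -- The first, incomplete block of D′ ends after j = k - r′ letters of f. Once it is dropped, the
  -- blocks of D start r + j letters before those of D′, and r < r′ < k puts this shift strictly
  -- between 0 and k.
  phase-shift⇒overhang : ∀ {f L T} (D D′ : Desubstitution f L) →
    Desubstitution.r D < Desubstitution.r D′ → T * k ≤ L → Overhang T
  phase-shift⇒overhang {f} {L} {T} D D′ r<r′ Tk≤L = record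
    { h = D.r + j
    ; v = D.g
    ; w = D′.g ∘ suc
    ; 0<h = ≤-trans (m<n⇒0<n∸m D′.r<k) (m≤n+m j D.r)
    ; h<k = <-≤-trans (+-monoˡ-< j r<r′) (≤-reflexive r′+j≡k)
    ; v∈S = 𝒮-prefix T (*-cancelʳ-≤ T D.m k (≤-trans Tk≤L (≤-trans (m≤n+m L D.r) D.fits))) D.g∈S
    ; w∈S = 𝒮-factor 1 T T<m′ D′.g∈S
    ; agree = λ n h+n<Tk → begin
        Φ D.g (D.r + j + n)        ≡⟨ cong (Φ D.g) (+-assoc D.r j n) ⟩
        Φ D.g (D.r + (j + n))      ≡⟨ D.reads (j + n) (j+n<L n h+n<Tk) ⟩
        f (j + n)                  ≡⟨ sym (D′.reads (j + n) (j+n<L n h+n<Tk)) ⟩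
        Φ D′.g (D′.r + (j + n))    ≡⟨ cong (Φ D′.g) (sym (+-assoc D′.r j n)) ⟩
        Φ D′.g (D′.r + j + n)      ≡⟨ cong (λ l → Φ D′.g (l + n)) r′+j≡k ⟩
        Φ D′.g (k + n)             ≡⟨ Φ-suc D′.g n ⟩
        Φ (D′.g ∘ suc) n           ∎
    }
    where
    open ≡-Reasoning
    module D = Desubstitution D
    module D′ = Desubstitution D′
    j = k ∸ D′.r
    r′+j≡k : D′.r + j ≡ k
    r′+j≡k = m+[n∸m]≡n (<⇒≤ D′.r<k)
    -- As r′ is positive, r′ + L exceeds T k, so T letters of g′ remain after its first one.
    T<m′ : T < D′.m
    T<m′ = *-cancelʳ-< k T D′.m
      (<-≤-trans (+-mono-<-≤ (≤-<-trans z≤n r<r′) Tk≤L) D′.fits)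
    j+n<L : ∀ n → D.r + j + n < T * k → j + n < L
    j+n<L n h+n<Tk = <-≤-trans (≤-<-trans (+-monoˡ-≤ n (m≤n+m j D.r)) h+n<Tk) Tk≤L

  -- Both words are prefixes of φ(v) of the same length i k.
  cut : ∀ {u} (I : Interpretation G u) → ∀ j i → j ≤ length u →
        i * k ≡ length (Interpretation.p I) + j →
        i ≤ length (Interpretation.v I) × φ (take i (Interpretation.v I)) ≡ Interpretation.p I ++ take j u
  cut {u} I j i j≤u ik≡ = i≤v , proj₁ (++-cancel-length (φ (take i v)) (p ++ take j u) lengths (begin
      φ (take i v) ++ φ (drop i v)          ≡⟨ sym (concatMap-++ image (take i v) (drop i v)) ⟩
      φ (take i v ++ drop i v)              ≡⟨ cong φ (take++drop≡id i v) ⟩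
      φ v                                   ≡⟨ φv≡pus ⟩
      p ++ u ++ s                           ≡⟨ cong (λ x → p ++ x ++ s) (sym (take++drop≡id j u)) ⟩
      p ++ (take j u ++ drop j u) ++ s      ≡⟨ cong (p ++_) (++-assoc (take j u) _ s) ⟩
      p ++ take j u ++ drop j u ++ s        ≡⟨ sym (++-assoc p _ _) ⟩
      (p ++ take j u) ++ drop j u ++ s      ∎))
    where
    open Interpretation I
    open ≡-Reasoning
    total : length p + (length u + length s) ≡ length v * k
    total = trans (sym (trans (length-++ p) (cong (length p +_) (length-++ u))))
                  (trans (cong length (sym φv≡pus)) (length-φ v))
    i≤v : i ≤ length v
    i≤v = *-cancelʳ-≤ i (length v) k (≤-trans (≤-reflexive ik≡)
      (≤-trans (+-monoʳ-≤ (length p) (≤-trans j≤u (m≤m+n _ _))) (≤-reflexive total)))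
    lengths : length (φ (take i v)) ≡ length (p ++ take j u)
    lengths = begin
      length (φ (take i v))          ≡⟨ length-φ (take i v) ⟩
      length (take i v) * k          ≡⟨ cong (_* k) (trans (length-take i v) (m≤n⇒m⊓n≡m i≤v)) ⟩
      i * k                          ≡⟨ ik≡ ⟩
      length p + j                   ≡⟨ cong (length p +_) (sym (trans (length-take j u) (m≤n⇒m⊓n≡m j≤u))) ⟩
      length p + length (take j u)   ≡⟨ sym (length-++ p) ⟩
      length (p ++ take j u)         ∎

  -- Two interpretations with different phases `length p % k` would yield an overhang. With equal
  -- phases, a block boundary of one interpretation is a boundary of all.
  no-overhang⇒synchronizing-point : ∀ {T} → 1 ≤ T → ¬ Overhang T →
    ∀ u → u ∈S → T * k ≤ length u → HasSynchronizingPoint G u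
  no-overhang⇒synchronizing-point {T} 1≤T none u u∈S Tk≤u = j , j≤u , sync
    where
    k≤u : k ≤ length u
    k≤u = ≤-trans (≤-trans (≤-reflexive (sym (*-identityˡ k))) (*-monoˡ-≤ k 1≤T)) Tk≤u
    I₀ = interpretation u∈S (≤-trans 2≤k k≤u)
    phase : Interpretation G u → ℕ
    phase I = length (Interpretation.p I) % k
    -- The first boundary after position 0; it is k when the phase is 0.
    j = k ∸ phase I₀
    j≤u : j ≤ length u
    j≤u = ≤-trans (m∸n≤m k (phase I₀)) k≤u
    not-below : ∀ I I′ → ¬ phase I < phase I′
    not-below I I′ r<r′ with D , refl ← reduce I | D′ , refl ← reduce I′ =
      none (phase-shift⇒overhang D D′ r<r′ Tk≤u)
    same-phase : ∀ I → phase I ≡ phase I₀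
    same-phase I = ≤-antisym (≮⇒≥ (not-below I₀ I)) (≮⇒≥ (not-below I I₀))
    index : Interpretation G u → ℕ
    index I = suc (length (Interpretation.p I) / k)
    index*k : ∀ I → index I * k ≡ length (Interpretation.p I) + j
    index*k I = begin
      k + l / k * k                          ≡⟨ cong (_+ l / k * k) (sym (m+[n∸m]≡n (<⇒≤ (m%n<n l₀ k)))) ⟩
      phase I₀ + j + l / k * k               ≡⟨ rearrange (phase I₀) j _ ⟩
      phase I₀ + l / k * k + j               ≡⟨ cong (λ r → r + l / k * k + j) (sym (same-phase I)) ⟩
      l % k + l / k * k + j                  ≡⟨ cong (_+ j) (sym (m≡m%n+[m/n]*n l k)) ⟩
      l + j                                  ∎
      where
      open ≡-Reasoning
      l = length (Interpretation.p I)
      l₀ = length (Interpretation.p I₀)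
      rearrange : ∀ x y z → x + y + z ≡ x + z + y
      rearrange = solve-∀
    sync : ∀ I I′ → SynchronizedAt G j I I′
    sync I I′ with i≤v , eq ← cut I j (index I) j≤u (index*k I)
                 | i′≤v′ , eq′ ← cut I′ j (index I′) j≤u (index*k I′) =
      index I , index I′ , i≤v , i′≤v′ , eq , eq′

  no-overhang⇒delay : ∀ {T B} → 1 ≤ T → 1 ≤ B → T * k ≤ suc B → ¬ Overhang T → IsSynchronizingDelay G B
  no-overhang⇒delay 1≤T 1≤B Tk≤ none =
    1≤B , λ u u∈S B<u → no-overhang⇒synchronizing-point 1≤T none u u∈S (≤-trans Tk≤ B<u)

  -- The common part of φ(v) and φ(w) has (2 + Z) k - h > Z letters and two interpretations, whose
  -- prefixes p have lengths h and 0. A synchronizing point at j would make k divide j + h and j,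
  -- hence h, although 0 < h < k.
  delay⇒no-overhang : ∀ {Z} → IsSynchronizingDelay G Z → ¬ Overhang (2 + Z)
  delay⇒no-overhang {Z} (_ , sync) O = clash
    (sync u u∈S (subst (Z <_) (sym (length-applyUpTo (Φ w) M)) Z<M))
    where
    open Overhang O
    l = k ∸ h
    M = l + (k + Z * k)
    u = applyUpTo (Φ w) M
    h+M≡ : h + M ≡ (2 + Z) * k
    h+M≡ = trans (sym (+-assoc h l _)) (cong (_+ (k + Z * k)) (m+[n∸m]≡n (<⇒≤ h<k)))
    Z<M : Z < M
    Z<M = ≤-trans (+-mono-≤ 0<k (m≤m*n Z k)) (m≤n+m (k + Z * k) l)
    u∈S : u ∈S
    u∈S = 𝒮-prefix M (≤-trans (m≤n+m M h) (≤-reflexive h+M≡)) (𝒮-Φ {w} w∈S)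
    I I′ : Interpretation G u
    I = record
      { p = applyUpTo (Φ v) h ; v = applyUpTo v (2 + Z) ; s = [] ; v∈S = v∈S
      ; φv≡pus = begin
          φ (applyUpTo v (2 + Z))              ≡⟨ φ-applyUpTo v (2 + Z) ⟩
          applyUpTo (Φ v) ((2 + Z) * k)        ≡⟨ cong (applyUpTo (Φ v)) (sym h+M≡) ⟩
          applyUpTo (Φ v) (h + M)              ≡⟨ applyUpTo-+ (Φ v) h M ⟩
          applyUpTo (Φ v) h ++ applyUpTo (Φ v ∘ (h +_)) M
            ≡⟨ cong (applyUpTo (Φ v) h ++_) (trans (applyUpTo-cong M λ i i<M →
                 agree i (<-≤-trans (+-monoʳ-< h i<M) (≤-reflexive h+M≡))) (sym (++-identityʳ u))) ⟩
          applyUpTo (Φ v) h ++ u ++ []         ∎ }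
      where open ≡-Reasoning
    I′ = record
      { p = [] ; v = applyUpTo w (2 + Z) ; s = applyUpTo (Φ w ∘ (M +_)) h ; v∈S = w∈S
      ; φv≡pus = begin
          φ (applyUpTo w (2 + Z))              ≡⟨ φ-applyUpTo w (2 + Z) ⟩
          applyUpTo (Φ w) ((2 + Z) * k)        ≡⟨ cong (applyUpTo (Φ w)) (trans (sym h+M≡) (+-comm h M)) ⟩
          applyUpTo (Φ w) (M + h)              ≡⟨ applyUpTo-+ (Φ w) M h ⟩
          u ++ applyUpTo (Φ w ∘ (M +_)) h      ∎ }
      where open ≡-Reasoning
    clash : ¬ HasSynchronizingPoint G u
    clash (j , _ , synced) with i , i′ , _ , _ , eq , eq′ ← synced I I′ =
      >⇒∤ {{>-nonZero 0<h}} h<k (∣m+n∣m⇒∣n (subst (k ∣_) lengths (n∣m*n (length (take i (applyUpTo v (2 + Z))))))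
        (subst (k ∣_) lengths′ (n∣m*n (length (take i′ (applyUpTo w (2 + Z)))))))
      where
      lengths : length (take i (applyUpTo v (2 + Z))) * k ≡ length (take j u) + h
      lengths = trans (sym (length-φ (take i (applyUpTo v (2 + Z))))) (trans (cong length eq)
        (trans (length-++ (applyUpTo (Φ v) h)) (trans (cong (_+ length (take j u)) (length-applyUpTo (Φ v) h)) (+-comm h _))))
      lengths′ : length (take i′ (applyUpTo w (2 + Z))) * k ≡ length (take j u)
      lengths′ = trans (sym (length-φ (take i′ (applyUpTo w (2 + Z))))) (cong length eq′)

  -- Overlaps between the images of the two letters.

  module Injective (injective : InjectiveOnFactors G) where

    img-injective : ∀ {c d} → (∀ i → i < k → img c i ≡ img d i) → c ≡ d
    img-injective {c} {d} eq = cong-head (injective [ c ] [ d ] (lettersOccur c) (lettersOccur d)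
      (cong (_++ []) (begin
        image c                                   ≡⟨ sym (applyUpTo-nth _) ⟩
        applyUpTo (img c) (length (image c))      ≡⟨ cong (applyUpTo (img c)) (uniform c) ⟩
        applyUpTo (img c) k                       ≡⟨ applyUpTo-cong k eq ⟩
        applyUpTo (img d) k                       ≡⟨ cong (applyUpTo (img d)) (sym (uniform d)) ⟩
        applyUpTo (img d) (length (image d))      ≡⟨ applyUpTo-nth _ ⟩
        image d                                   ∎)))
      where
      open ≡-Reasoning
      cong-head : ∀ {x y : Fin 2} → [ x ] ≡ [ y ] → x ≡ y
      cong-head refl = refl

    Agree : ℕ → Set
    Agree i = img a i ≡ img b i

    AgreeOn : ℕ → ℕ → Set
    AgreeOn o m = ∀ i → i < m → Agree (o + i)

    agreeOn? : ∀ o m → Dec (AgreeOn o m)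
    agreeOn? o m with allUpTo? (λ i → img a (o + i) ≟ᶠ img b (o + i)) m
    ... | yes all = yes λ i i<m → all i<m
    ... | no ¬all = no λ all → ¬all (λ {i} → all i)

    agree⇒ : ∀ {i} → Agree i → ∀ c d → img c i ≡ img d i
    agree⇒ eq a a = refl
    agree⇒ eq a b = eq
    agree⇒ eq b a = sym eq
    agree⇒ eq b b = refl

    ⇒agree : ∀ {i c d} → c ≢ d → img c i ≡ img d i → Agree i
    ⇒agree {c = a} {a} c≢d eq = contradiction refl c≢d
    ⇒agree {c = a} {b} c≢d eq = eq
    ⇒agree {c = b} {a} c≢d eq = sym eq
    ⇒agree {c = b} {b} c≢d eq = contradiction refl c≢d

    ¬agree-everywhere : ¬ (∀ i → i < k → Agree i)
    ¬agree-everywhere agree = contradiction (img-injective {a} {b} agree) λ ()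

    -- φ(c) without its first p letters is a prefix of φ(d).
    Overlap : ℕ → Fin 2 → Fin 2 → Set
    Overlap p c d = ∀ i → p + i < k → img c (p + i) ≡ img d i

    module _ {p q} (p+q≡k : p + q ≡ k) where

      p+i<k : ∀ {i} → i < q → p + i < k
      p+i<k i<q = <-≤-trans (+-monoʳ-< p i<q) (≤-reflexive p+q≡k)

      i<q : ∀ {i} → p + i < k → i < q
      i<q lt = +-cancelˡ-< p _ _ (<-≤-trans lt (≤-reflexive (sym p+q≡k)))

      split-at : ∀ {n} → n < k → n < p ⊎ (∃[ i ] n ≡ p + i × i < q)
      split-at {n} n<k with n <? p
      ... | yes n<p = inj₁ n<p
      ... | no  n≮p with i , refl ← m≤n⇒∃[o]m+o≡n (≮⇒≥ n≮p) = inj₂ (i , refl , i<q n<k)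

      -- Agreement spreads to the right: position p + i of either image copies position i of some
      -- image, where by induction the choice of image does not matter. Thus φ(a) = φ(b), against
      -- injectivity.
      prefix-clash : 0 < p → AgreeOn 0 p → ¬ (∀ c → ∃[ d ] Overlap p c d)
      prefix-clash 0<p agree partner = ¬agree-everywhere λ i i<k → below (suc i) i ≤-refl i<k
        where
        -- Strong induction on n, with m as an upper bound for it.
        below : ∀ m n → n < m → n < k → Agree n
        below (suc m) n (s≤s n≤m) n<k with split-at n<k
        ... | inj₁ n<p = agree n n<p
        ... | inj₂ (i , refl , _) with d , a→d ← partner a | d′ , b→d′ ← partner b =
          trans (a→d i n<k) (trans (agree⇒ (below m i i<m (≤-<-trans (m≤n+m i p) n<k)) d d′) (sym (b→d′ i n<k)))
          where
          i<m : i < m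
          i<m = <-≤-trans (+-monoˡ-< i 0<p) n≤m

      -- The mirror image of `prefix-clash`: agreement spreads from the last q letters to the left.
      suffix-clash : 0 < q → AgreeOn p q → ¬ (∀ c → ∃[ d ] Overlap q d c)
      suffix-clash 0<q agree partner = ¬agree-everywhere λ i i<k → above k i (m≤n+m k i) i<k
        where
        above : ∀ m n → k ≤ n + m → n < k → Agree n
        above m n k≤ n<k with split-at n<k
        ... | inj₂ (i , refl , i<q) = agree i i<q
        above zero    n k≤ n<k | inj₁ n<p = contradiction (≤-trans k≤ (≤-reflexive (+-identityʳ n))) (<⇒≱ n<k)
        above (suc m) n k≤ n<k | inj₁ n<p with d , d→a ← partner a | d′ , d′→b ← partner b =
          trans (sym (d→a n q+n<k)) (trans (agree⇒ (above m (q + n) k≤′ q+n<k) d d′) (d′→b n q+n<k))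
          where
          q+n<k : q + n < k
          q+n<k = <-≤-trans (+-monoʳ-< q n<p) (≤-reflexive (trans (+-comm q p) p+q≡k))
          k≤′ : k ≤ q + n + m
          k≤′ = ≤-trans (≤-trans k≤ (≤-reflexive (+-suc n m))) (+-monoˡ-≤ m (+-monoˡ-≤ n 0<q))

      overlap-target : AgreeOn 0 q → ∀ {c d} → Overlap p c d → ∀ d′ → Overlap p c d′
      overlap-target agree {d = d} ov d′ i lt = trans (ov i lt) (agree⇒ (agree i (i<q lt)) d d′)

      overlap-source : AgreeOn p q → ∀ {c d} → Overlap p c d → ∀ c′ → Overlap p c′ d
      overlap-source agree {c} ov c′ i lt = trans (agree⇒ (agree i (i<q lt)) c′ c) (ov i lt)

      -- Two different targets would share their first q letters, all of which are read off φ(c).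
      target-unique : ¬ AgreeOn 0 q → ∀ {c d d′} → Overlap p c d → Overlap p c d′ → d ≡ d′
      target-unique ¬agree {d = d} {d′} ov ov′ with d ≟ᶠ d′
      ... | yes d≡d′ = d≡d′
      ... | no  d≢d′ = contradiction
        (λ i i<q → ⇒agree d≢d′ (trans (sym (ov i (p+i<k i<q))) (ov′ i (p+i<k i<q)))) ¬agree

      source-unique : ¬ AgreeOn p q → ∀ {c c′ d} → Overlap p c d → Overlap p c′ d → c ≡ c′
      source-unique ¬agree {c} {c′} ov ov′ with c ≟ᶠ c′
      ... | yes c≡c′ = c≡c′
      ... | no  c≢c′ = contradiction
        (λ i i<q → ⇒agree c≢c′ (trans (ov i (p+i<k i<q)) (sym (ov′ i (p+i<k i<q))))) ¬agree

    -- The two overlaps say that φ(d) is φ(c) rotated by p letters, so c determines φ(d) and with it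
    -- d.
    overlaps-determine : ∀ {p q} → p + q ≡ k → ∀ {c d d′} →
      Overlap p c d → Overlap q d c → Overlap p c d′ → Overlap q d′ c → d ≡ d′
    overlaps-determine {p} {q} p+q≡k {c} {d} {d′} c→d d→c c→d′ d′→c = img-injective same
      where
      q+p≡k = trans (+-comm q p) p+q≡k
      same : ∀ i → i < k → img d i ≡ img d′ i
      same i i<k with split-at q+p≡k i<k
      ... | inj₁ i<q = trans (sym (c→d i (p+i<k p+q≡k i<q))) (c→d′ i (p+i<k p+q≡k i<q))
      ... | inj₂ (i′ , refl , _) = trans (d→c i′ i<k) (sym (d′→c i′ i<k))

    -- Constant images, runs and full blocks.

    AllIs : Fin 2 → Fin 2 → Set
    AllIs c z = ∀ i → i < k → img c i ≡ z

    scan : ∀ c z → AllIs c z ⊎ (∃[ i ] i < k × img c i ≡ other z)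
    scan c z with anyUpTo? (λ i → img c i ≟ᶠ other z) k
    ... | yes found = inj₂ found
    ... | no  none  = inj₁ λ i i<k → trans
      (≢⇒≡other {other z} (λ eq → none (i , i<k , sym eq))) (other-involutive z)

    Φ-letter : ∀ {c z} → AllIs c z → ∀ n → Φ (const c) n ≡ z
    Φ-letter all n = all (n % k) (m%n<n n k)

    Φ-const-periodic : ∀ c → Periodic (Φ (const c)) k
    Φ-const-periodic c = Φ-suc (const c)

    double≤ : ∀ n → n + n ≤ n * k
    double≤ n = ≤-trans (≤-reflexive (two n)) (*-monoʳ-≤ n 2≤k)
      where
      two : ∀ n → n + n ≡ n * 2
      two = solve-∀

    run-grows : ∀ {c z} → AllIs c z → ∀ n → 𝒮 (const c) (suc n) → 𝒮 (const z) (2 + n)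
    run-grows {c} {z} all n c∈ = 𝒮-cong {Φ (const c)} (λ i _ → Φ-letter all i)
      (𝒮-prefix {Φ (const c)} (2 + n)
        (≤-trans (s≤s (m≤n+m (suc n) n)) (double≤ (suc n))) (𝒮-Φ {const c} c∈))

    -- Whatever the phase r, a block starts at one of the first k positions and ends within the
    -- first 2k - 1 letters.
    full-block : ∀ {f n} → 2 * k ≤ suc n → 𝒮 f n →
                 ∃[ c ] ∃[ o ] ∀ i → i < k → o + i < n × f (o + i) ≡ img c i
    full-block {f} {n} 2k≤ f∈ = inside r refl
      where
      k+k≤ : k + k ≤ suc n
      k+k≤ = ≤-trans (≤-reflexive (cong (k +_) (sym (+-identityʳ k)))) 2k≤
      k<n : k < n
      k<n = ≤-pred (≤-trans (+-monoˡ-≤ k 2≤k) k+k≤)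
      open Desubstitution (desubstitute (<⇒≤ (≤-<-trans 2≤k k<n)) f∈)
      inside : ∀ r′ → r′ ≡ r → ∃[ c ] ∃[ o ] ∀ i → i < k → o + i < n × f (o + i) ≡ img c i
      inside zero eq = g 0 , 0 , λ i i<k → <-trans i<k k<n ,
        trans (sym (reads i (<-trans i<k k<n))) (trans (cong (λ r → Φ g (r + i)) (sym eq)) (Φ-head g i<k))
      inside (suc r′) eq = g 1 , k ∸ r , λ i i<k → bound i i<k , (begin
        f (k ∸ r + i)               ≡⟨ sym (reads _ (bound i i<k)) ⟩
        Φ g (r + (k ∸ r + i))       ≡⟨ cong (Φ g) (sym (+-assoc r _ i)) ⟩
        Φ g (r + (k ∸ r) + i)       ≡⟨ cong (λ l → Φ g (l + i)) (m+[n∸m]≡n (<⇒≤ r<k)) ⟩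
        Φ g (k + i)                 ≡⟨ Φ-suc g i ⟩
        Φ (g ∘ suc) i               ≡⟨ Φ-head (g ∘ suc) i<k ⟩
        img (g 1) i                 ∎)
        where
        open ≡-Reasoning
        bound : ∀ i → i < k → k ∸ r + i < n
        bound i i<k = ≤-trans (≤-reflexive (sym (+-suc _ i))) (≤-pred (≤-trans (+-mono-≤ k∸r<k i<k) k+k≤))
          where
          k∸r<k : k ∸ r < k
          k∸r<k = subst (λ r → k ∸ r < k) eq (∸-monoʳ-< {k} (s≤s z≤n) (≤-trans (≤-reflexive eq) (<⇒≤ r<k)))

    -- A run of z cannot meet the image of a letter c whose image avoids z.
    run-lift : ∀ {c d z n} → d ≢ z → AllIs c d → 2 ≤ n → 𝒮 (const z) n →
               ∃[ r ] ∀ i → i < n → Φ (const (other c)) (r + i) ≡ z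
    run-lift {c} {d} {z} d≢z all 2≤n z∈ = r , λ i i<n → lifted (r + i) (reads i i<n)
      where
      open Desubstitution (desubstitute {const z} 2≤n z∈)
      lifted : ∀ p → Φ g p ≡ z → Φ (const (other c)) p ≡ z
      lifted p eq = trans (cong (λ e → img e (p % k)) (sym (≢⇒≡other c≢))) eq
        where
        c≢ : c ≢ g (p / k)
        c≢ c≡ = d≢z (trans (sym (all (p % k) (m%n<n p k))) (trans (cong (λ e → img e (p % k)) c≡) eq))

    -- Every position of the run at distance at least m from both its ends lies in a block φ(y):
    -- in a block φ(x) it would belong to m + 1 consecutive letters x of that block.
    trim : ∀ {x} m j {n} → 2 ≤ n → m + m < k →
           (∀ o → o + m < k → ¬ (∀ i → i ≤ m → img x (o + i) ≡ x)) →
           m + m + j * k < n → 𝒮 (const x) n → 𝒮 (const (other x)) (suc j)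
    trim {x} m j {n} 2≤n 2m<k no-run long x∈ = 𝒮-cong {g ∘ (q +_)} (λ i i≤j → other-letter i (≤-pred i≤j))
      (𝒮-factor {g} q (suc j) (≤-trans (≤-reflexive (+-suc q j)) q+j<) g∈S)
      where
      open Desubstitution (desubstitute {const x} 2≤n x∈) renaming (m to M)
      centre : ∀ p → r + m ≤ p → p + m < r + n → g (p / k) ≡ other x
      centre p r+m≤p p+m< with g (p / k) ≟ᶠ x
      ... | no  neq = ≢⇒≡other (neq ∘ sym)
      ... | yes eq  with t , e , e<k , refl ← divide p = contradiction run (no-run o o+m<k)
        where
        gt≡x : g t ≡ x
        gt≡x = trans (cong g (sym (block-/ t e<k))) eq
        -- The window o, ..., o + m contains the offset e. It ends at e, or starts at 0 when e < m,
        -- and then fits into the block because 2m < k.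
        o = e ∸ m
        o+m<k : o + m < k
        o+m<k with m ≤? e
        ... | yes m≤e = ≤-<-trans (≤-reflexive (m∸n+n≡m m≤e)) e<k
        ... | no  m≰e = ≤-<-trans (≤-reflexive (cong (_+ m) (m≤n⇒m∸n≡0 (<⇒≤ (≰⇒> m≰e))))) (≤-<-trans (m≤m+n m m) 2m<k)
        r≤t*k+o : r ≤ t * k + o
        r≤t*k+o with m ≤? e
        ... | yes m≤e = +-cancelʳ-≤ m r _ (≤-trans r+m≤p (≤-reflexive
          (trans (cong (t * k +_) (sym (m∸n+n≡m m≤e))) (sym (+-assoc (t * k) o m)))))
        ... | no  m≰e = +-cancelʳ-≤ m r _ (≤-trans r+m≤p (≤-trans (+-monoʳ-≤ (t * k) (<⇒≤ (≰⇒> m≰e)))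
          (+-monoˡ-≤ m (m≤m+n (t * k) o))))
        run : ∀ i → i ≤ m → img x (o + i) ≡ x
        run i i≤m with l , l≡ ← m≤n⇒∃[o]m+o≡n (≤-trans r≤t*k+o (m≤m+n (t * k + o) i)) = begin
          img x (o + i)           ≡⟨ cong (λ c → img c (o + i)) (sym gt≡x) ⟩
          img (g t) (o + i)       ≡⟨ sym (Φ-block g t (≤-<-trans (+-monoʳ-≤ o i≤m) o+m<k)) ⟩
          Φ g (t * k + (o + i))   ≡⟨ cong (Φ g) (sym (+-assoc (t * k) o i)) ⟩
          Φ g (t * k + o + i)     ≡⟨ cong (Φ g) (sym l≡) ⟩
          Φ g (r + l)             ≡⟨ reads l (+-cancelˡ-< r l n (≤-<-trans (≤-reflexive l≡) (≤-<-trans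
                                       (+-mono-≤ (+-monoʳ-≤ (t * k) (m∸n≤m e m)) i≤m) p+m<))) ⟩
          x                       ∎
          where open ≡-Reasoning
      q = (r + m) / k
      -- One position in each of j + 1 consecutive blocks; for i at most j they all keep distance m
      -- from the ends of the run.
      position : ℕ → ℕ
      position i = i * k + (r + m)
      position-/ : ∀ i → position i / k ≡ q + i
      position-/ i = trans (+-distrib-/-∣ˡ (r + m) (n∣m*n i)) (trans (cong (_+ q) (m*n/n≡m i k)) (+-comm i q))
      inside : ∀ i → i ≤ j → position i + m < r + n
      inside i i≤j = ≤-<-trans (≤-trans (+-monoˡ-≤ m (+-monoˡ-≤ (r + m) (*-monoˡ-≤ k i≤j)))
        (≤-reflexive (rearrange (j * k) r m))) (+-monoʳ-< r long)
        where
        rearrange : ∀ x r m → x + (r + m) + m ≡ r + (m + m + x)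
        rearrange = solve-∀
      other-letter : ∀ i → i ≤ j → g (q + i) ≡ other x
      other-letter i i≤j = trans (cong g (sym (position-/ i)))
        (centre (position i) (m≤n+m (r + m) (i * k)) (inside i i≤j))
      q+j< : q + j < M
      q+j< = subst (_< M) (position-/ j)
        (m<n*o⇒m/o<n (<-≤-trans (≤-<-trans (m≤m+n (position j) m) (inside j ≤-refl)) fits))

    -- A run of k + 1 letters meets exactly two blocks.
    long-run : ∀ {z} → 𝒮 (const z) (suc k) →
               ∃[ c ] ∃[ d ] suc k ≤ count z (img c) k + count z (img d) k
    long-run {z} z∈ = g 0 , g 1 , ≤-trans (≤-reflexive (sym total)) (+-mono-≤ left right)
      where
      open Desubstitution (desubstitute {const z} (m≤n⇒m≤1+n 2≤k) z∈)
      -- The run takes l letters at the end of the block of `g 0` and r + 1 at the beginning of the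
      -- block of `g 1`.
      l = k ∸ r
      r+l≡k : r + l ≡ k
      r+l≡k = m+[n∸m]≡n (<⇒≤ r<k)
      total : l + suc r ≡ suc k
      total = trans (+-suc l r) (cong suc (trans (+-comm l r) r+l≡k))
      left : l ≤ count z (img (g 0)) k
      left = begin
        l                                                    ≡⟨ sym (count-const z l (λ i i<l →
            trans (sym (Φ-head g (<-≤-trans (+-monoʳ-< r i<l) (≤-reflexive r+l≡k))))
              (reads i (<-≤-trans i<l (m≤n⇒m≤1+n (m∸n≤m k r)))))) ⟩
        count z (img (g 0) ∘ (r +_)) l                       ≤⟨ m≤n+m _ (count z (img (g 0)) r) ⟩
        count z (img (g 0)) r + count z (img (g 0) ∘ (r +_)) l ≡⟨ sym (count-+ z (img (g 0)) r l) ⟩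
        count z (img (g 0)) (r + l)                          ≡⟨ cong (count z (img (g 0))) r+l≡k ⟩
        count z (img (g 0)) k                                ∎
        where open ≤-Reasoning
      right : suc r ≤ count z (img (g 1)) k
      right with o , 1+r+o≡k ← m≤n⇒∃[o]m+o≡n r<k = begin
        suc r                                ≡⟨ sym (count-const z (suc r) hits) ⟩
        count z (img (g 1)) (suc r)          ≤⟨ m≤m+n _ _ ⟩
        count z (img (g 1)) (suc r) + count z (img (g 1) ∘ (suc r +_)) o ≡⟨ sym (count-+ z (img (g 1)) (suc r) o) ⟩
        count z (img (g 1)) (suc r + o)      ≡⟨ cong (count z (img (g 1))) 1+r+o≡k ⟩
        count z (img (g 1)) k                ∎
        where
        open ≤-Reasoning
        hits : ∀ i → i < suc r → img (g 1) i ≡ z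
        hits i i<1+r = trans (sym (trans (Φ-suc g i) (Φ-head (g ∘ suc) (<-≤-trans i<1+r r<k))))
          (trans (cong (λ m → Φ g (m + i)) (sym r+l≡k)) (trans (cong (Φ g) (+-assoc r l i))
            (reads (l + i) (<-≤-trans (+-monoʳ-< l i<1+r) (≤-reflexive total)))))

    -- Two different letters of f would be the whole alphabet, and R would hold for every letter.
    one-letter : ∀ {R : Fin 2 → Set} (f : ℕ → Fin 2) {n} → ¬ (∀ c → R c) → (∀ t → t < n → R (f t)) →
                 ∀ t → t < n → f t ≡ f 0
    one-letter {R} f {n} ¬all holds t t<n with f t ≟ᶠ f 0
    ... | yes eq = eq
    ... | no neq = contradiction
      (λ c → case ≢-covers neq c of λ where
        (inj₁ refl) → holds t t<n
        (inj₂ refl) → holds 0 (≤-<-trans z≤n t<n)) ¬all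

    -- Rigidity of overhangs with a fixed shift.

    module Shift {h h′} (h+h′≡k : h + h′ ≡ k) (0<h : 0 < h) (0<h′ : 0 < h′) where

      h′+h≡k : h′ + h ≡ k
      h′+h≡k = trans (+-comm h′ h) h+h′≡k

      -- Each block of φ(w) splits after h′ letters: the first part is the end of one block of φ(v),
      -- the rest the beginning of the next.
      overlaps⇒Φ : ∀ v w → (∀ t → Overlap h (v t) (w t)) → (∀ t → Overlap h′ (w t) (v (suc t))) →
                   ∀ n → Φ v (h + n) ≡ Φ w n
      overlaps⇒Φ v w v→w w→v n with t , i , i<k , refl ← divide n with split-at h′+h≡k i<k
      ... | inj₁ i<h′ = begin
        Φ v (h + (t * k + i))   ≡⟨ cong (Φ v) (swap h (t * k) i) ⟩
        Φ v (t * k + (h + i))   ≡⟨ Φ-block v t h+i<k ⟩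
        img (v t) (h + i)       ≡⟨ v→w t i h+i<k ⟩
        img (w t) i             ≡⟨ sym (Φ-block w t i<k) ⟩
        Φ w (t * k + i)         ∎
        where
        open ≡-Reasoning
        h+i<k = p+i<k h+h′≡k i<h′
        swap : ∀ x y z → x + (y + z) ≡ y + (x + z)
        swap = solve-∀
      ... | inj₂ (j , refl , j<h) = begin
        Φ v (h + (t * k + (h′ + j)))  ≡⟨ cong (Φ v) (swap h (t * k) h′ j) ⟩
        Φ v (h + h′ + t * k + j)      ≡⟨ cong (λ l → Φ v (l + t * k + j)) h+h′≡k ⟩
        Φ v (suc t * k + j)           ≡⟨ Φ-block v (suc t) (≤-<-trans (m≤n+m j h′) i<k) ⟩
        img (v (suc t)) j             ≡⟨ sym (w→v t j i<k) ⟩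
        img (w t) (h′ + j)            ≡⟨ sym (Φ-block w t i<k) ⟩
        Φ w (t * k + (h′ + j))        ∎
        where
        open ≡-Reasoning
        swap : ∀ x y z t → x + (y + (z + t)) ≡ x + z + y + t
        swap = solve-∀

      Φ⇒overlap : ∀ {v w T} → (∀ n → h + n < T * k → Φ v (h + n) ≡ Φ w n) →
                  ∀ t → t < T → Overlap h (v t) (w t)
      Φ⇒overlap {v} {w} {T} agree t t<T i h+i<k = begin
        img (v t) (h + i)       ≡⟨ sym (Φ-block v t h+i<k) ⟩
        Φ v (t * k + (h + i))   ≡⟨ cong (Φ v) (swap (t * k) h i) ⟩
        Φ v (h + (t * k + i))   ≡⟨ agree (t * k + i) bound ⟩
        Φ w (t * k + i)         ≡⟨ Φ-block w t (≤-<-trans (m≤n+m i h) h+i<k) ⟩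
        img (w t) i             ∎
        where
        open ≡-Reasoning
        swap : ∀ x y z → x + (y + z) ≡ y + (x + z)
        swap = solve-∀
        bound : h + (t * k + i) < T * k
        bound = ≤-<-trans (≤-reflexive (sym (swap (t * k) h i)))
          (<-≤-trans (+-monoʳ-< (t * k) h+i<k) (≤-trans (≤-reflexive (+-comm (t * k) k)) (*-monoˡ-≤ k t<T)))

      Φ⇒overlap′ : ∀ {v w T} → (∀ n → h + n < T * k → Φ v (h + n) ≡ Φ w n) →
                   ∀ t → suc t < T → Overlap h′ (w t) (v (suc t))
      Φ⇒overlap′ {v} {w} {T} agree t t<T i h′+i<k = begin
        img (w t) (h′ + i)            ≡⟨ sym (Φ-block w t h′+i<k) ⟩
        Φ w (t * k + (h′ + i))        ≡⟨ sym (agree _ bound) ⟩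
        Φ v (h + (t * k + (h′ + i)))  ≡⟨ cong (Φ v) shift ⟩
        Φ v (suc t * k + i)           ≡⟨ Φ-block v (suc t) i<k ⟩
        img (v (suc t)) i             ∎
        where
        open ≡-Reasoning
        i<k = ≤-<-trans (m≤n+m i h′) h′+i<k
        swap : ∀ x y z t → x + (y + (z + t)) ≡ x + z + y + t
        swap = solve-∀
        shift : h + (t * k + (h′ + i)) ≡ suc t * k + i
        shift = trans (swap h (t * k) h′ i) (cong (λ l → l + t * k + i) h+h′≡k)
        bound : h + (t * k + (h′ + i)) < T * k
        bound = ≤-<-trans (≤-reflexive shift)
          (<-≤-trans (+-monoʳ-< (suc t * k) i<k) (≤-trans (≤-reflexive (+-comm (suc t * k) k)) (*-monoˡ-≤ k t<T)))

      -- In an overhang of N + 1 letters, the blocks of the first letter of v and the last letter of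
      -- w lie only partly in the overlap. These two letters are left free.
      record Constant (N : ℕ) (v w : ℕ → Fin 2) : Set where
        field
          x y : Fin 2
          x→y : Overlap h x y
          y→x : Overlap h′ y x
          v≡x : ∀ t → t < N → v (suc t) ≡ x
          w≡y : ∀ t → t < N → w t ≡ y

      record Alternating (N : ℕ) (v : ℕ → Fin 2) : Set where
        field
          x y   : Fin 2
          x→y   : Overlap h x y
          y→x̄   : Overlap h′ y (other x)
          x̄→ȳ   : Overlap h (other x) (other y)
          ȳ→x   : Overlap h′ (other y) x
          v≡alt : ∀ t → t < suc N → v t ≡ alt x t

      -- If φ(a) and φ(b) agree on a prefix or suffix of length h or h′, a clash lemma makes v or w
      -- constant, and conjugacy then fixes the other. If they agree on none, each letter determines
      -- the next in the sequence v 0, w 0, v 1, ... and conversely, so v is constant or alternates.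
      classify : ∀ {N v w} → 2 ≤ N → (∀ t → t < suc N → Overlap h (v t) (w t)) →
                 (∀ t → t < N → Overlap h′ (w t) (v (suc t))) → Constant N v w ⊎ Alternating N v
      classify {N} {v} {w} 2≤N v→w w→v
        with agreeOn? 0 h | agreeOn? 0 h′ | agreeOn? h h′ | agreeOn? h′ h
      ... | yes agree | _ | _ | _ = inj₁ record
        { x = v 0 ; y = w 0 ; x→y = v→w 0 z<s ; y→x = w→x 0 0<N
        ; v≡x = λ t t<N → v≡x (suc t) (s≤s t<N)
        ; w≡y = λ t t<N → overlaps-determine h+h′≡k (x→w t t<N) (w→x t t<N) (x→w 0 0<N) (w→x 0 0<N) }
        where
        0<N = ≤-trans (s≤s z≤n) 2≤N
        v≡x : ∀ t → t < suc N → v t ≡ v 0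
        v≡x = one-letter v (prefix-clash h+h′≡k 0<h agree) (λ t t<T → w t , v→w t t<T)
        x→w : ∀ t → t < N → Overlap h (v 0) (w t)
        x→w t t<N = subst (λ c → Overlap h c (w t)) (v≡x t (m<n⇒m<1+n t<N)) (v→w t (m<n⇒m<1+n t<N))
        w→x : ∀ t → t < N → Overlap h′ (w t) (v 0)
        w→x t t<N = subst (Overlap h′ (w t)) (v≡x (suc t) (s≤s t<N)) (w→v t t<N)
      ... | no _ | yes agree | _ | _ = inj₁ record
        { x = v 1 ; y = w 0 ; x→y = v→y 0 0<N ; y→x = w→v 0 0<N
        ; v≡x = λ t t<N → overlaps-determine h′+h≡k (y→v t t<N) (v→y t t<N) (y→v 0 0<N) (v→y 0 0<N)
        ; w≡y = w≡y }
        where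
        0<N = ≤-trans (s≤s z≤n) 2≤N
        w≡y : ∀ t → t < N → w t ≡ w 0
        w≡y = one-letter w (prefix-clash h′+h≡k 0<h′ agree) (λ t t<N → v (suc t) , w→v t t<N)
        -- For t = N - 1 the letter w N is not known to be w 0, but both images share the h′ letters
        -- that the overlap reads.
        v→y : ∀ t → t < N → Overlap h (v (suc t)) (w 0)
        v→y t t<N = overlap-target h+h′≡k agree (v→w (suc t) (s≤s t<N)) (w 0)
        y→v : ∀ t → t < N → Overlap h′ (w 0) (v (suc t))
        y→v t t<N = subst (λ c → Overlap h′ c (v (suc t))) (w≡y t t<N) (w→v t t<N)
      ... | no _ | no _ | yes agree | _ = inj₁ record
        { x = v 1 ; y = w 0 ; x→y = x→w 0 0<N ; y→x = w→v 0 0<N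
        ; v≡x = v≡x
        ; w≡y = λ t t<N → overlaps-determine h+h′≡k (x→w t t<N) (w→x t t<N) (x→w 0 0<N) (w→x 0 0<N) }
        where
        0<N = ≤-trans (s≤s z≤n) 2≤N
        v≡x : ∀ t → t < N → v (suc t) ≡ v 1
        v≡x = one-letter (v ∘ suc) (suffix-clash h+h′≡k 0<h′ agree) (λ t t<N → w t , w→v t t<N)
        -- For t = 0 the letter v 0 is free, but both images share the suffix that the overlap
        -- reads.
        x→w : ∀ t → t < N → Overlap h (v 1) (w t)
        x→w t t<N = overlap-source h+h′≡k agree (v→w t (m<n⇒m<1+n t<N)) (v 1)
        w→x : ∀ t → t < N → Overlap h′ (w t) (v 1)
        w→x t t<N = subst (Overlap h′ (w t)) (v≡x t t<N) (w→v t t<N)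
      ... | no _ | no _ | no _ | yes agree = inj₁ record
        { x = v 1 ; y = w 0 ; x→y = v→y 0 0<N ; y→x = w→v 0 0<N
        ; v≡x = λ t t<N → overlaps-determine h′+h≡k (y→v t t<N) (v→y t t<N) (y→v 0 0<N) (v→y 0 0<N)
        ; w≡y = λ t t<N → w≡y t (m<n⇒m<1+n t<N) }
        where
        0<N = ≤-trans (s≤s z≤n) 2≤N
        w≡y : ∀ t → t < suc N → w t ≡ w 0
        w≡y = one-letter w (suffix-clash h′+h≡k 0<h agree) (λ t t<T → v t , v→w t t<T)
        v→y : ∀ t → t < N → Overlap h (v (suc t)) (w 0)
        v→y t t<N = subst (Overlap h (v (suc t))) (w≡y (suc t) (s≤s t<N)) (v→w (suc t) (s≤s t<N))
        y→v : ∀ t → t < N → Overlap h′ (w 0) (v (suc t))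
        y→v t t<N = subst (λ c → Overlap h′ c (v (suc t))) (w≡y t (m<n⇒m<1+n t<N)) (w→v t t<N)
      ... | no ¬agree₁ | no ¬agree₂ | no ¬agree₃ | no ¬agree₄ = outcome (v 0 ≟ᶠ v 1)
        where
        v⇒w : ∀ s t → s < suc N → t < suc N → v s ≡ v t → w s ≡ w t
        v⇒w s t s<T t<T eq = target-unique h+h′≡k ¬agree₂ (v→w s s<T)
          (subst (λ c → Overlap h c (w t)) (sym eq) (v→w t t<T))
        w⇒v : ∀ s t → s < suc N → t < suc N → w s ≡ w t → v s ≡ v t
        w⇒v s t s<T t<T eq = source-unique h+h′≡k ¬agree₃ (v→w s s<T)
          (subst (Overlap h (v t)) (sym eq) (v→w t t<T))
        w⇒v′ : ∀ s t → s < N → t < N → w s ≡ w t → v (suc s) ≡ v (suc t)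
        w⇒v′ s t s<N t<N eq = target-unique h′+h≡k ¬agree₁ (w→v s s<N)
          (subst (λ c → Overlap h′ c (v (suc t))) (sym eq) (w→v t t<N))
        v⇒w′ : ∀ s t → s < N → t < N → v (suc s) ≡ v (suc t) → w s ≡ w t
        v⇒w′ s t s<N t<N eq = source-unique h′+h≡k ¬agree₄ (w→v s s<N)
          (subst (Overlap h′ (w t)) (sym eq) (w→v t t<N))
        -- The step from v t to v (t + 1) is a well-defined injection on letters, so its first value
        -- decides.
        outcome : Dec (v 0 ≡ v 1) → Constant N v w ⊎ Alternating N v
        outcome (yes v0≡v1) = inj₁ record
          { x = v 0 ; y = w 0 ; x→y = v→w 0 z<s
          ; y→x = subst (Overlap h′ (w 0)) (sym v0≡v1) (w→v 0 0<N)
          ; v≡x = λ t t<N → v≡x (suc t) (s≤s t<N)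
          ; w≡y = λ t t<N → v⇒w t 0 (m<n⇒m<1+n t<N) z<s (v≡x t (m<n⇒m<1+n t<N)) }
          where
          0<N = ≤-trans (s≤s z≤n) 2≤N
          v≡x : ∀ t → t < suc N → v t ≡ v 0
          v≡x zero    _         = refl
          v≡x (suc t) (s≤s t<N) = trans
            (w⇒v′ t 0 t<N 0<N (v⇒w t 0 (m<n⇒m<1+n t<N) z<s (v≡x t (m<n⇒m<1+n t<N)))) (sym v0≡v1)
        outcome (no v0≢v1) = inj₂ record
          { x = v 0 ; y = w 0 ; x→y = v→w 0 z<s
          ; y→x̄ = subst (Overlap h′ (w 0)) v1≡ (w→v 0 0<N)
          ; x̄→ȳ = subst₂ (Overlap h) v1≡ w1≡ (v→w 1 1<T)
          ; ȳ→x = subst₂ (Overlap h′) w1≡ v2≡ (w→v 1 2≤N)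
          ; v≡alt = alternates⇒alt v (suc N) alternates }
          where
          0<N = ≤-trans (s≤s z≤n) 2≤N
          1<T = m<n⇒m<1+n 2≤N
          alternates : ∀ t → suc t < suc N → v t ≢ v (suc t)
          alternates zero    _         eq = v0≢v1 eq
          alternates (suc t) (s≤s t<N) eq = alternates t t<T (w⇒v t (suc t) (<-trans (n<1+n t) t<T) t<T (v⇒w′ t (suc t) (<-trans (n<1+n t) t<N) t<N eq))
            where t<T = m<n⇒m<1+n t<N
          v1≡ : v 1 ≡ other (v 0)
          v1≡ = ≢⇒≡other v0≢v1
          w1≡ : w 1 ≡ other (w 0)
          w1≡ = ≢⇒≡other λ eq → v0≢v1 (w⇒v 0 1 z<s 1<T eq)
          v2≡ : v 2 ≡ v 0
          v2≡ = trans (≢⇒≡other (alternates 1 (s≤s 2≤N))) (trans (cong other v1≡) (other-involutive (v 0)))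

      h<k : h < k
      h<k = <-≤-trans (m<m+n h 0<h′) (≤-reflexive h+h′≡k)

      -- φ(x) and φ(y) are conjugate, so they contain the same number of letters of each kind.
      conjugate-runs : ∀ {x y} → x ≢ y → Overlap h x y → Overlap h′ y x →
                       𝒮 (const x) (suc k) → ¬ 𝒮 (const y) (suc k)
      conjugate-runs {x} {y} x≢y x→y y→x x∈ y∈ = contradiction sum≥ (<⇒≱ sum<)
        where
        conjugate : ∀ z → count z (img x) k ≡ count z (img y) k
        conjugate z = begin
          count z (img x) k                                       ≡⟨ cong (count z (img x)) (sym h+h′≡k) ⟩
          count z (img x) (h + h′)                                ≡⟨ count-+ z (img x) h h′ ⟩
          count z (img x) h + count z (img x ∘ (h +_)) h′
            ≡⟨ cong₂ _+_ (count-cong z h λ i i<h → sym (y→x i (p+i<k h′+h≡k i<h)))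
                         (count-cong z h′ λ i i<h′ → x→y i (p+i<k h+h′≡k i<h′)) ⟩
          count z (img y ∘ (h′ +_)) h + count z (img y) h′        ≡⟨ +-comm _ (count z (img y) h′) ⟩
          count z (img y) h′ + count z (img y ∘ (h′ +_)) h        ≡⟨ sym (count-+ z (img y) h′ h) ⟩
          count z (img y) (h′ + h)                                ≡⟨ cong (count z (img y)) h′+h≡k ⟩
          count z (img y) k                                       ∎
          where open ≡-Reasoning
        same : ∀ z c → count z (img c) k ≡ count z (img x) k
        same z c with ≢-covers x≢y c
        ... | inj₁ refl = refl
        ... | inj₂ refl = sym (conjugate z)
        twice : ∀ {z} → 𝒮 (const z) (suc k) → suc k ≤ count z (img x) k + count z (img x) k
        twice {z} z∈ with c , d , le ← long-run z∈ = subst₂ (λ m n → suc k ≤ m + n) (same z c) (same z d) le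
        -- Both runs together require twice the number of letters x and y in φ(x) to be 2k + 2, but
        -- these numbers add up to k.
        sum≥ : suc k + suc k ≤ k + k
        sum≥ = ≤-trans (+-mono-≤ (twice x∈) (twice y∈)) (≤-reflexive (begin
          X + X + (Y + Y)     ≡⟨ exchange X Y ⟩
          X + Y + (X + Y)     ≡⟨ cong (λ c → X + count c (img x) k + (X + count c (img x) k)) (≢⇒≡other x≢y) ⟩
          X + X̄ + (X + X̄)     ≡⟨ cong (λ m → m + m) (count-other x (img x) k) ⟩
          k + k               ∎))
          where
          open ≡-Reasoning
          X = count x (img x) k
          Y = count y (img x) k
          X̄ = count (other x) (img x) k
          exchange : ∀ x y → x + x + (y + y) ≡ x + y + (x + y)
          exchange = solve-∀
        sum< : k + k < suc k + suc k
        sum< = +-mono-< (n<1+n k) (n<1+n k)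

      module _ {Z} (delay : IsSynchronizingDelay G Z) where

        -- The form in which circularity is used: unboundedly long factors must not be produced
        -- along an overlap of infinite words.
        no-infinite-overhang : ∀ v w → (∀ n → Φ v (h + n) ≡ Φ w n) → ¬ (∀ T → 𝒮 v T × 𝒮 w T)
        no-infinite-overhang v w agree ∈S = delay⇒no-overhang delay record
          { h = h ; v = v ; w = w ; 0<h = 0<h ; h<k = h<k
          ; v∈S = proj₁ (∈S (2 + Z)) ; w∈S = proj₂ (∈S (2 + Z)) ; agree = λ n _ → agree n }

        -- An image overlapping itself.

        module SelfOverlap {x} (x→x : Overlap h x x) (x→x′ : Overlap h′ x x) where

          y : Fin 2
          y = other x

          F : ℕ → Fin 2
          F = Φ (const x)

          F-h : Periodic F h
          F-h = overlaps⇒Φ (const x) (const x) (λ _ → x→x) (λ _ → x→x′)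

          -- Infinite repetition of φ(x) has the periods h and k, hence g: φ(x) is a proper power of
          -- a word of length g.
          g : ℕ
          g = gcd h k

          g∣k : g ∣ k
          g∣k = gcd[m,n]∣n h k

          0<g : 0 < g
          0<g = n≢0⇒n>0 λ g≡0 → m<n⇒n≢0 0<h (gcd[m,n]≡0⇒m≡0 g≡0)

          g<k : g < k
          g<k = ≤-<-trans (∣⇒≤ {{>-nonZero 0<h}} (gcd[m,n]∣m h k)) h<k

          F-g : Periodic F g
          F-g = periodic-gcd F-h (Φ-const-periodic x)

          F-head : ∀ {i} → i < k → F i ≡ img x i
          F-head = Φ-head (const x)

          -- A window of g letters covers a full period.
          F-window : ∀ {z} r → (∀ i → i < g → F (r + i) ≡ z) → AllIs x z
          F-window r all n n<k with i , i<g , eq ← periodic-window F-g 0<g r n =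
            trans (sym (F-head n<k)) (trans (eq 0) (all i i<g))

          bounded-runs : ¬ (∀ n → 𝒮 (const x) (suc n))
          bounded-runs x∈S = no-infinite-overhang (const x) (const x) F-h λ T →
            𝒮-prefix T (n≤1+n T) (x∈S T) , 𝒮-prefix T (n≤1+n T) (x∈S T)

          ¬fixed : ¬ AllIs x x
          ¬fixed all = bounded-runs runs
            where
            runs : ∀ n → 𝒮 (const x) (suc n)
            runs zero    = 𝒮-letter x 1 ≤-refl
            runs (suc n) = run-grows all n (runs n)

          -- Runs of x and of y lengthen each other under φ, so both are unbounded, against
          -- `bounded-runs`.
          ¬swapped : AllIs x y → ¬ AllIs y x
          ¬swapped all all′ = bounded-runs λ n → proj₁ (runs n)
            where
            runs : ∀ n → 𝒮 (const x) (suc n) × 𝒮 (const y) (suc n)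
            runs zero    = 𝒮-letter x 1 ≤-refl , 𝒮-letter y 1 ≤-refl
            runs (suc n) = run-grows all′ n (proj₂ (runs n)) , run-grows all n (proj₁ (runs n))

          two-letters⇒g≢1 : ∀ {i j} → i < k → j < k → img x i ≡ other x → img x j ≡ x → g ≢ 1
          two-letters⇒g≢1 {i} {j} i<k j<k xi≡y xj≡x g≡1 = other≢ x (begin
            other x  ≡⟨ sym xi≡y ⟩
            img x i  ≡⟨ F-window j (λ { zero i<g → at-j ; (suc i) i<g → contradiction (subst (suc i <_) g≡1 i<g) λ { (s≤s ()) } }) i i<k ⟩
            x        ∎)
            where
            open ≡-Reasoning
            at-j : F (j + 0) ≡ x
            at-j = trans (cong F (+-identityʳ j)) (trans (F-head j<k) xj≡x)

          g≥2 : g ≢ 1 → ∃[ g′ ] g ≡ 2 + g′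
          g≥2 g≢1 with g | 0<g
          ... | suc zero    | _ = contradiction refl g≢1
          ... | suc (suc n) | _ = n , refl

          -- Here φ(y) is a power of x and φ(x) contains both letters, so every y in an image comes
          -- from φ(x).
          module Mixed (yx : AllIs y x) {i j} (i<k : i < k) (j<k : j < k)
                       (xi≡y : img x i ≡ y) (xj≡x : img x j ≡ x) where

            lift : ∀ {n} → 𝒮 (const y) (suc n) → ∃[ r ] ∀ e → e < suc n → F (r + e) ≡ y
            -- A single letter cannot be desubstituted, so a known occurrence of y in φ(x) is used.
            lift {zero}  _  = i , λ { zero _ → trans (cong F (+-identityʳ i)) (trans (F-head i<k) xi≡y)
                                    ; (suc _) (s≤s ()) }
            lift {suc n} y∈ with r , all ← run-lift {y} (other≢ x ∘ sym) yx (s≤s (s≤s z≤n)) y∈ =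
              r , λ e e< → trans (cong (λ c → Φ (const c) (r + e)) (sym (other-involutive x))) (all e e<)

            ¬y-run : ∀ g′ → g ≡ 2 + g′ → ¬ 𝒮 (const y) (2 + g′)
            ¬y-run g′ g≡ y∈ with r , all ← lift y∈ = other≢ x (trans
              (sym (F-window r (λ e e<g → all e (subst (e <_) g≡ e<g)) j j<k)) xj≡x)

            -- A run of g - 1 letters y in F leaves a single x in each period.
            ¬double-x : ∀ g′ → g ≡ 2 + g′ → 𝒮 (const y) (suc g′) → ∀ o → o + 1 < k →
                        ¬ (∀ e → e ≤ 1 → img x (o + e) ≡ x)
            ¬double-x g′ g≡ y∈ o o+1<k xx with r , all ← lift y∈
              with e , e<g , eq ← periodic-window F-g 0<g r o = conclude (e ≟ suc g′)
              where
              F-o : F o ≡ x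
              F-o = trans (F-head (≤-<-trans (m≤m+n o 1) o+1<k)) (trans (cong (img x) (sym (+-identityʳ o))) (xx 0 z≤n))
              F-suc-o : F (suc o) ≡ x
              F-suc-o = trans (cong F (+-comm 1 o)) (trans (F-head o+1<k) (xx 1 ≤-refl))
              conclude : Dec (e ≡ suc g′) → ⊥
              conclude (no neq) = other≢ x (trans (sym (all e (≤∧≢⇒< (≤-pred (subst (e <_) g≡ e<g)) neq)))
                (trans (sym (eq 0)) F-o))
              conclude (yes refl) = other≢ x (begin
                other x               ≡⟨ sym (all 0 z<s) ⟩
                F (r + 0)             ≡⟨ cong F (+-identityʳ r) ⟩
                F r                   ≡⟨ sym (F-g r) ⟩
                F (g + r)             ≡⟨ cong (λ m → F (m + r)) g≡ ⟩
                F (2 + g′ + r)        ≡⟨ cong (F ∘ suc) (+-comm (suc g′) r) ⟩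
                F (suc (r + suc g′))  ≡⟨ sym (eq 1) ⟩
                F (suc o)             ≡⟨ F-suc-o ⟩
                x                     ∎)
                where open ≡-Reasoning

            -- Two rounds of `trim`. As φ(x) is not constant, it has no g consecutive letters x, and
            -- the run of x yields a run of g - 1 letters y. By `¬double-x`, φ(x) then contains no
            -- xx, so trimming with m = 1 yields g letters y, which `¬y-run` forbids. The second
            -- round needs more than 2 + (g - 1) k letters.
            run-bound : ∀ {n} → k * (g ∸ 1) + 2 < n → ¬ 𝒮 (const x) n
            run-bound {n} long x∈ with g′ , g≡ ← g≥2 (two-letters⇒g≢1 i<k j<k xi≡y xj≡x) =
              ¬y-run g′ g≡ (trim {x} 1 (suc g′) 2≤n 2<k (¬double-x g′ g≡ fewer) long₂ x∈)
              where
              long′ : k * suc g′ + 2 < n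
              long′ = subst (λ m → k * (m ∸ 1) + 2 < n) g≡ long
              2≤n : 2 ≤ n
              2≤n = ≤-trans (m≤n+m 2 _) (<⇒≤ long′)
              g+g≤k : g + g ≤ k
              g+g≤k with g∣k
              ... | divides zero          k≡ = contradiction k≡ (m<n⇒n≢0 0<k)
              ... | divides (suc zero)    k≡ = contradiction (trans k≡ (+-identityʳ g)) (>⇒≢ g<k)
              ... | divides (suc (suc q)) k≡ = ≤-trans (+-monoʳ-≤ g (m≤m+n g (q * g))) (≤-reflexive (sym k≡))
              4+2g′≤k : 2 + g′ + (2 + g′) ≤ k
              4+2g′≤k = subst (λ m → m + m ≤ k) g≡ g+g≤k
              2<k : 2 < k
              2<k = ≤-trans (s≤s (s≤s (≤-trans (s≤s z≤n) (m≤n+m (2 + g′) g′)))) 4+2g′≤k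
              m+m<k : suc g′ + suc g′ < k
              m+m<k = ≤-trans (s≤s (s≤s (+-monoʳ-≤ g′ (n≤1+n (suc g′))))) 4+2g′≤k
              long₂ : 2 + suc g′ * k < n
              long₂ = ≤-<-trans (≤-reflexive (trans (+-comm 2 _) (cong (_+ 2) (*-comm (suc g′) k)))) long′
              long₁ : suc g′ + suc g′ + g′ * k < n
              long₁ = <-trans (<-≤-trans (+-monoˡ-< (g′ * k) m+m<k) (≤-reflexive (*-comm (suc g′) k)))
                (≤-<-trans (m≤m+n _ 2) long′)
              fewer : 𝒮 (const y) (suc g′)
              fewer = trim {x} (suc g′) g′ 2≤n m+m<k (λ o o+ all → other≢ x (trans (sym xi≡y)
                (F-window o (λ e e<g → let e≤ = ≤-pred (subst (e <_) g≡ e<g) in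
                  trans (F-head (≤-<-trans (+-monoʳ-≤ o e≤) o+)) (all e e≤)) i i<k))) long₁ x∈

          -- If φ(x) is a power of x, or φ swaps the letters up to powers, runs are unbounded. If
          -- φ(y) is a power of x and φ(x) is mixed, then g > 1, so k is not prime and `run-bound`
          -- applies. If both images contain y, no full block fits into a run of x.
          self-overlap-run-bound : ∀ {N} → Long (suc N) → ¬ 𝒮 (const x) N
          self-overlap-run-bound {N} long x∈ with scan x x | scan y x | scan x y
          ... | inj₁ xx | _ | _ = ¬fixed xx
          ... | inj₂ _ | inj₁ yx | inj₁ xy = ¬swapped xy yx
          ... | inj₂ (i , i<k , xi≡y) | inj₁ yx | inj₂ (j , j<k , xj≡ȳ) = mixed long
            where
            xj≡x = trans xj≡ȳ (other-involutive x)
            mixed : ¬ Long (suc N)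
            mixed (inj₁ (k-prime , _)) with prime⇒irreducible k-prime g∣k
            ... | inj₁ g≡1 = two-letters⇒g≢1 i<k j<k xi≡y xj≡x g≡1
            ... | inj₂ g≡k = <⇒≢ g<k g≡k
            -- The run is one letter shorter than T, so the bound k (g - 1) + 4 leaves N > k (g - 1)
            -- + 2.
            mixed (inj₂ (_ , wide)) = Mixed.run-bound yx i<k j<k xi≡y xj≡x
              (≤-pred (≤-trans (≤-reflexive (trans (cong suc (sym (+-suc _ 2))) (sym (+-suc _ 3)))) (wide g∣k g<k))) x∈
          ... | inj₂ (i , i<k , xi≡y) | inj₂ (j , j<k , yj≡y) | _ = unmixed long
            where
            unmixed : ¬ Long (suc N)
            unmixed (inj₂ (2k≤ , _)) with c , o , block ← full-block 2k≤ x∈ with c ≟ᶠ x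
            ... | yes refl = other≢ x (trans (sym xi≡y) (sym (proj₂ (block i i<k))))
            ... | no c≢x = other≢ x (trans (sym yj≡y) (trans (cong (λ c → img c j) (sym (≢⇒≡other (c≢x ∘ sym))))
                             (sym (proj₂ (block j j<k)))))
            -- The run need not contain a full block here. But g = 1 makes φ(x) a power of y, so k
            -- letters x would fill a whole period of repeated φ(y), which contains y.
            unmixed (inj₁ (k-prime , 2+k≤)) with prime⇒irreducible k-prime g∣k
            ... | inj₂ g≡k = <⇒≢ g<k g≡k
            ... | inj₁ g≡1 = conclude (run-lift {x} (other≢ x) all-y 2≤k x∈k)
              where
              all-y : AllIs x y
              all-y = F-window i λ { zero _ → trans (cong F (+-identityʳ i)) (trans (F-head i<k) xi≡y)
                                   ; (suc e) e<g → contradiction (subst (suc e <_) g≡1 e<g) λ { (s≤s ()) } }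
              x∈k : 𝒮 (const x) k
              x∈k = 𝒮-prefix k (≤-trans (n≤1+n k) (≤-pred 2+k≤)) x∈
              conclude : ¬ (∃[ r ] ∀ e → e < k → Φ (const y) (r + e) ≡ x)
              conclude (r , all) with e , e<k , eq ← periodic-window (Φ-const-periodic y) 0<k r j =
                other≢ x (trans (sym yj≡y) (trans (sym (Φ-head (const y) j<k)) (trans (eq 0) (all e e<k))))

        -- Overlaps along alternating words.

        module AlternatingOverlap {x y} (x→y : Overlap h x y) (y→x̄ : Overlap h′ y (other x))
                                  (x̄→ȳ : Overlap h (other x) (other y)) (ȳ→x : Overlap h′ (other y) x) where

          F : ℕ → Fin 2
          F = Φ (alt x)

          along-alt : ∀ {P : Fin 2 → Fin 2 → Set} {c d} → P c d → P (other c) (other d) →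
                      ∀ t → P (alt c t) (alt d t)
          along-alt Pcd Pc̄d̄ zero = Pcd
          along-alt {P} {c} {d} Pcd Pc̄d̄ (suc t) = along-alt {P} Pc̄d̄
            (subst₂ P (sym (other-involutive c)) (sym (other-involutive d)) Pcd) t

          alt-2 : ∀ t → alt x (2 + t) ≡ alt x t
          alt-2 t = cong (λ c → alt c t) (other-involutive x)

          F-h : ∀ n → F (h + n) ≡ Φ (alt y) n
          F-h = overlaps⇒Φ (alt x) (alt y) (along-alt {Overlap h} x→y x̄→ȳ)
            (along-alt {λ d c → Overlap h′ d c} y→x̄ (subst (Overlap h′ (other y)) (sym (other-involutive x)) ȳ→x))

          F-k : ∀ n → F (k + n) ≡ Φ (alt (other x)) n
          F-k = Φ-suc (alt x)

          F-2k : Periodic F (2 * k)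
          F-2k n = trans (Φ-+ (alt x) 2 n) (Φ-cong alt-2 n)

          F-block : ∀ c → ∃[ o ] ∀ i → i < k → F (o + i) ≡ img c i
          F-block c with c ≟ᶠ x
          ... | yes refl = 0 , λ i i<k → Φ-head (alt x) i<k
          ... | no  c≢x  = k , λ i i<k → trans (F-k i) (trans (Φ-head (alt (other x)) i<k)
                                           (cong (λ c → img c i) (sym (≢⇒≡other (c≢x ∘ sym)))))

          -- The blocks of F are φ(x) and φ(`other x`) in turn, and period k would make them equal.
          ¬F-period-k : ¬ Periodic F k
          ¬F-period-k per = other≢ x (img-injective λ i i<k → trans (sym (Φ-head (alt (other x)) i<k))
            (trans (sym (F-k i)) (trans (per i) (Φ-head (alt x) i<k))))

          -- The image of an alternating factor would alternate again and be longer, so alternating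
          -- factors would be unbounded and give an infinite overhang.
          ¬F-alternates : 𝒮 (alt x) 3 → ¬ (∀ n → F n ≢ F (suc n))
          ¬F-alternates x∈ alternates = no-infinite-overhang (alt x) (alt y) F-h
            λ T → 𝒮-prefix {alt x} T (m≤n+m T 2) (runs T) , y∈ T
            where
            F≡alt : ∀ n → F n ≡ alt (F 0) n
            F≡alt n = alternates⇒alt F (suc n) (λ i _ → alternates i) n ≤-refl
            grow : ∀ T → 3 + T < (2 + T) * k
            grow T = ≤-trans (≤-of-+≡ T (four T)) (double≤ (2 + T))
              where
              four : ∀ T → 4 + T + T ≡ 2 + T + (2 + T)
              four = solve-∀
            runs : ∀ T → 𝒮 (alt x) (2 + T)
            runs zero    = 𝒮-prefix {alt x} 2 (n≤1+n 2) x∈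
            runs (suc T) with F∈ ← 𝒮-Φ {alt x} (runs T) | F 0 ≟ᶠ x
            ... | yes F0≡x = 𝒮-cong {F} (λ i _ → trans (F≡alt i) (cong (λ c → alt c i) F0≡x))
              (𝒮-prefix {F} (3 + T) (<⇒≤ (grow T)) F∈)
            -- An image with the wrong initial letter loses that letter, which the strict bound
            -- `grow` allows.
            ... | no  F0≢x = 𝒮-cong {F ∘ suc} (λ i _ → trans (F≡alt (suc i))
                (trans (cong (λ c → alt (other c) i) (≢⇒≡other (F0≢x ∘ sym))) (alt-2 i)))
              (𝒮-factor {F} 1 (3 + T) (grow T) F∈)
            y∈ : ∀ T → 𝒮 (alt y) T
            y∈ T with y ≟ᶠ x
            ... | yes refl = 𝒮-prefix {alt x} T (m≤n+m T 2) (runs T)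
            ... | no  y≢x  = 𝒮-cong {alt x ∘ suc} (λ i _ → cong (λ c → alt c i) (sym (≢⇒≡other (y≢x ∘ sym))))
              (𝒮-factor {alt x} 1 T (s≤s (n≤1+n T)) (runs T))

          -- If y = x, the shift by h maps F to itself. Otherwise it has the same effect as the
          -- shift by k, and since 2k is a period, so is k + h.
          shift : ∃[ s ] 0 < s × s < 2 * k × Periodic F s
          shift with y ≟ᶠ x
          ... | yes refl = h , 0<h , <-≤-trans h<k (m≤m+n k _) , F-h
          ... | no  y≢x  = k + h , ≤-trans 0<k (m≤m+n k h)
            , +-monoʳ-< k (<-≤-trans h<k (≤-reflexive (sym (+-identityʳ k))))
            , λ n → begin
                F (k + h + n)                ≡⟨ cong F (swap k h n) ⟩
                F (h + (k + n))              ≡⟨ F-h (k + n) ⟩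
                Φ (alt y) (k + n)            ≡⟨ Φ-cong (λ i → cong (λ c → alt c i) (≢⇒≡other (y≢x ∘ sym))) (k + n) ⟩
                Φ (alt (other x)) (k + n)    ≡⟨ sym (F-k (k + n)) ⟩
                F (k + (k + n))              ≡⟨ cong F (double k n) ⟩
                F (2 * k + n)                ≡⟨ F-2k n ⟩
                F n                          ∎
            where
            open ≡-Reasoning
            swap : ∀ x y z → x + y + z ≡ y + (x + z)
            swap = solve-∀
            double : ∀ x z → x + (x + z) ≡ 2 * x + z
            double = solve-∀

          s : ℕ
          s = proj₁ shift

          0<s : 0 < s
          0<s = proj₁ (proj₂ shift)

          s<2k : s < 2 * k
          s<2k = proj₁ (proj₂ (proj₂ shift))

          g : ℕ
          g = gcd s (2 * k)

          0<g : 0 < g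
          0<g = n≢0⇒n>0 λ g≡0 → m<n⇒n≢0 0<s (gcd[m,n]≡0⇒m≡0 g≡0)

          F-g : Periodic F g
          F-g = periodic-gcd (proj₂ (proj₂ (proj₂ shift))) F-2k

          g∤k : g ∤ k
          g∤k (divides q k≡) = ¬F-period-k (subst (Periodic F) (sym k≡) (periodic-* F-g q))

          -- 2k = q g, where q = 1 contradicts 0 < s < 2k, and q = 2 contradicts g ∤ k.
          g<k : g < k
          g<k with gcd[m,n]∣n s (2 * k)
          ... | divides zero 2k≡ = contradiction 2k≡ (m<n⇒n≢0 (≤-trans 0<k (m≤m+n k _)))
          ... | divides 1 2k≡ = contradiction (∣⇒≤ {{>-nonZero 0<s}} (gcd[m,n]∣m s (2 * k)))
            (<⇒≱ (<-≤-trans s<2k (≤-reflexive (trans 2k≡ (+-identityʳ g)))))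
          ... | divides 2 2k≡ = contradiction (∣-reflexive (sym (*-cancelˡ-≡ k g 2 2k≡))) g∤k
          ... | divides (suc (suc (suc q))) 2k≡ = *-cancelˡ-< 2 g k (<-≤-trans
            (+-monoʳ-< g (m<m+n (g + 0) (≤-trans 0<g (m≤m+n g (q * g)))))
            (≤-reflexive (trans (cong (λ m → g + (m + (g + q * g))) (+-identityʳ g)) (sym 2k≡))))

          window-alternates : ∀ o → (∀ i → i < g → F (o + i) ≢ F (suc (o + i))) → ∀ n → F n ≢ F (suc n)
          window-alternates o alternates n with i , i<g , eq ← periodic-window F-g 0<g o n =
            λ same → alternates i i<g (trans (sym (eq 0)) (trans same (eq 1)))

          -- For prime k the period g divides 2k but not k, so it is 2.
          prime⇒g≡2 : Prime k → g ≡ 2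
          prime⇒g≡2 k-prime with gcd[m,n]∣n s (2 * k)
          ... | divides q 2k≡ with euclidsLemma q g k-prime (divides 2 (sym 2k≡))
          ... | inj₂ k∣g = contradiction g<k (≤⇒≯ (∣⇒≤ {{>-nonZero 0<g}} k∣g))
          ... | inj₁ (divides r refl) with irreducible[2] (divides {g} {2} r 2≡)
            where
            2≡ : 2 ≡ r * g
            2≡ = *-cancelʳ-≡ 2 (r * g) k (trans 2k≡ (rearrange r k g))
              where
              rearrange : ∀ r k g → r * k * g ≡ r * g * k
              rearrange = solve-∀
          ... | inj₁ g≡1 = contradiction (subst (_∣ k) (sym g≡1) (1∣ k)) g∤k
          ... | inj₂ g≡2 = g≡2

          -- It suffices that F alternates on one period. For prime k the period is 2, and F 0 = F 1
          -- would make F constant. Otherwise the factor contains a full block, which alternates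
          -- and, as g < k, covers a period of F and the letter after it.
          alternating-run-bound : ∀ {T} → 3 ≤ T → Long T → ¬ 𝒮 (alt x) T
          alternating-run-bound {T} 3≤T long x∈ = ¬F-alternates (𝒮-prefix {alt x} 3 3≤T x∈) (alternates long)
            where
            alternates : Long T → ∀ n → F n ≢ F (suc n)
            alternates (inj₁ (k-prime , _)) = window-alternates 0 window
              where
              F-2 : Periodic F 2
              F-2 = subst (Periodic F) (prime⇒g≡2 k-prime) F-g
              F0≢F1 : F 0 ≢ F 1
              F0≢F1 F0≡F1 = ¬F-period-k λ n → trans (F≡F0 (k + n)) (sym (F≡F0 n))
                where
                F≡F0 : ∀ n → F n ≡ F 0
                F≡F0 zero          = refl
                F≡F0 (suc zero)    = sym F0≡F1
                F≡F0 (suc (suc n)) = trans (F-2 n) (F≡F0 n)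
              window : ∀ i → i < g → F i ≢ F (suc i)
              window zero          _   = F0≢F1
              window (suc zero)    _   = λ F1≡F2 → F0≢F1 (sym (trans F1≡F2 (F-2 0)))
              window (suc (suc i)) i<g = contradiction (subst (2 + i <_) (prime⇒g≡2 k-prime) i<g)
                λ { (s≤s (s≤s ())) }
            alternates (inj₂ (2k≤T , _)) with c , o , block ← full-block {alt x} (m≤n⇒m≤1+n 2k≤T) x∈
              with o′ , block′ ← F-block c = window-alternates o′ λ i i<g F≡ →
                let 1+i<k = ≤-<-trans i<g g<k
                    i<k   = <-trans (n<1+n i) 1+i<k in
                other≢ (alt x (o + i)) (begin
                  other (alt x (o + i))   ≡⟨ sym (alt-suc x (o + i)) ⟩
                  alt x (suc (o + i))     ≡⟨ cong (alt x) (sym (+-suc o i)) ⟩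
                  alt x (o + suc i)       ≡⟨ proj₂ (block (suc i) 1+i<k) ⟩
                  img c (suc i)           ≡⟨ sym (block′ (suc i) 1+i<k) ⟩
                  F (o′ + suc i)          ≡⟨ cong F (+-suc o′ i) ⟩
                  F (suc (o′ + i))        ≡⟨ sym F≡ ⟩
                  F (o′ + i)              ≡⟨ block′ i i<k ⟩
                  img c i                 ≡⟨ sym (proj₂ (block i i<k)) ⟩
                  alt x (o + i)           ∎)
              where open ≡-Reasoning

    -- Exclusion of long overhangs.

    long⇒2+k≤ : ∀ {T} → Long T → 2 + k ≤ T
    long⇒2+k≤ (inj₁ (_ , 2+k≤T)) = 2+k≤T
    long⇒2+k≤ (inj₂ (2k≤T , _))  =
      ≤-trans (+-monoˡ-≤ k 2≤k) (≤-trans (≤-reflexive (cong (k +_) (sym (+-identityʳ k)))) 2k≤T)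

    long⇒no-overhang : ∀ {Z T} → IsSynchronizingDelay G Z → Long T → ¬ Overhang T
    long⇒no-overhang {T = zero} _ long _ = contradiction (long⇒2+k≤ long) λ ()
    long⇒no-overhang {T = suc N} delay long O = conclude (classify 2≤N (Φ⇒overlap {v} {w} agree)
        λ t t<N → Φ⇒overlap′ {v} {w} agree t (s≤s t<N))
      where
      open Overhang O
      open Shift (m+[n∸m]≡n (<⇒≤ h<k)) 0<h (m<n⇒0<n∸m h<k) hiding (h<k)
      -- With one end letter lost on each side, the k + 1 letters for `conjugate-runs` remain.
      1+k≤N : suc k ≤ N
      1+k≤N = ≤-pred (long⇒2+k≤ long)
      2≤N : 2 ≤ N
      2≤N = ≤-trans 2≤k (≤-trans (n≤1+n k) 1+k≤N)
      conclude : ¬ (Constant N v w ⊎ Alternating N v)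
      conclude (inj₁ C) = both-runs (x ≟ᶠ y)
        where
        open Constant C
        x∈ : 𝒮 (const x) N
        x∈ = 𝒮-cong {v ∘ suc} v≡x (𝒮-factor {v} 1 N ≤-refl v∈S)
        y∈ : 𝒮 (const y) N
        y∈ = 𝒮-cong {w} w≡y (𝒮-prefix {w} N (n≤1+n N) w∈S)
        both-runs : ¬ Dec (x ≡ y)
        both-runs (yes x≡y) = SelfOverlap.self-overlap-run-bound delay
          (subst (Overlap h x) (sym x≡y) x→y) (subst (λ c → Overlap (k ∸ h) c x) (sym x≡y) y→x) long x∈
        both-runs (no x≢y) = conjugate-runs x≢y x→y y→x
          (𝒮-prefix {const x} (suc k) 1+k≤N x∈) (𝒮-prefix {const y} (suc k) 1+k≤N y∈)
      conclude (inj₂ A) = AlternatingOverlap.alternating-run-bound delay x→y y→x̄ x̄→ȳ ȳ→x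
        (s≤s 2≤N) long (𝒮-cong {v} v≡alt v∈S)
        where open Alternating A

    long⇒delay : ∀ {Z T B} → IsSynchronizingDelay G Z → Long T → 1 ≤ B → T * k ≤ suc B →
                 IsSynchronizingDelay G B
    long⇒delay delay long 1≤B Tk≤ =
      no-overhang⇒delay (≤-trans (s≤s z≤n) (long⇒2+k≤ long)) 1≤B Tk≤ (long⇒no-overhang delay long)

-- Arithmetic of the bounds and divisors of k.

odd-prime-arithmetic : ∀ {k} → 3 ≤ k →
  1 ≤ k ^ 2 + 3 * k ∸ 4 × (2 + k) * k ≤ suc (k ^ 2 + 3 * k ∸ 4)
-- With k = 3 + j the truncated subtraction disappears; the inequality is k² + 2k - 1 ≤ k² + 3k - 4.
odd-prime-arithmetic 3≤k with j , refl ← m≤n⇒∃[o]m+o≡n 3≤k =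
  subst (λ B → 1 ≤ B × (5 + j) * (3 + j) ≤ suc B) (sym (cong (_∸ 4) (total j)))
    (s≤s z≤n , ≤-of-+≡ j (enough j))
  where
  total : ∀ j → (3 + j) * ((3 + j) * 1) + 3 * (3 + j) ≡ 4 + (14 + 9 * j + j * j)
  total = solve-∀
  enough : ∀ j → (5 + j) * (3 + j) + j ≡ suc (14 + 9 * j + j * j)
  enough = solve-∀

composite-arithmetic : ∀ {k} q → 4 ≤ k →
  1 ≤ k ^ 2 * q + 5 * k ∸ 4 × (k * q + 4) * k ≤ suc (k ^ 2 * q + 5 * k ∸ 4)
composite-arithmetic {k} q 4≤k with j , refl ← m≤n⇒∃[o]m+o≡n 4≤k =
  subst (λ B → 1 ≤ B × (k * q + 4) * k ≤ suc B) (sym (cong (_∸ 4) (total j q)))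
    (≤-trans (s≤s z≤n) (≤-trans (m≤n+m _ _) (m≤m+n _ j)) , ≤-of-+≡ (suc j) (enough j q))
  where
  total : ∀ j q → (4 + j) * ((4 + j) * 1) * q + 5 * (4 + j) ≡ 4 + ((4 + j) * ((4 + j) * 1) * q + 4 * (4 + j) + j)
  total = solve-∀
  enough : ∀ j q → ((4 + j) * q + 4) * (4 + j) + suc j ≡ suc ((4 + j) * ((4 + j) * 1) * q + 4 * (4 + j) + j)
  enough = solve-∀

module LeastDivisor {k d} (2≤k : 2 ≤ k) (least : IsLeastDivisor>1 k d) where

  1<d : 1 < d
  1<d = proj₁ (proj₁ least)

  least-divisor≡k⇒prime : d ≡ k → Prime k
  least-divisor≡k⇒prime refl = irreducible⇒prime {{n>1⇒nonTrivial 2≤k}} irreducible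
    where
    irreducible : ∀ {e} → e ∣ k → e ≡ 1 ⊎ e ≡ k
    irreducible {zero}        e∣k = contradiction (0∣⇒≡0 e∣k) (m<n⇒n≢0 2≤k)
    irreducible {suc zero}    e∣k = inj₁ refl
    irreducible {suc (suc e)} e∣k = inj₂ (≤-antisym (∣⇒≤ {{>-nonZero (<⇒≤ 2≤k)}} e∣k)
      (proj₂ least (2 + e) (s≤s (s≤s z≤n) , e∣k)))

  -- The complementary divisor k / g exceeds 1, so it is at least d.
  proper-divisor≤ : ∀ {q g} → k ≡ q * d → g ∣ k → g < k → g ≤ q
  proper-divisor≤ k≡qd (divides zero k≡) g<k = contradiction k≡ (m<n⇒n≢0 g<k)
  proper-divisor≤ {g = g} k≡qd (divides 1 k≡) g<k =
    contradiction (≤-reflexive (trans k≡ (+-identityʳ g))) (<⇒≱ g<k)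
  proper-divisor≤ {q} {g} k≡qd (divides e@(suc (suc _)) k≡) g<k =
    *-cancelʳ-≤ g q d {{>-nonZero (<⇒≤ 1<d)}} (begin
      g * d   ≤⟨ *-monoʳ-≤ g (proj₂ least e (s≤s (s≤s z≤n) , divides g (trans k≡ (*-comm e g)))) ⟩
      g * e   ≡⟨ trans (*-comm g e) (trans (sym k≡) k≡qd) ⟩
      q * d   ∎)
    where open ≤-Reasoning

  -- For q = k / d = 1 the number k is prime, hence 2 or odd. For q = 2 the least divisor is 2 and k
  -- = 4, where the second inequality is an equality. For larger q already k (q - 1) is at least 2k.
  composite : k ≢ 2 → ¬ OddPrime k → ∀ q → k ≡ q * d →
              4 ≤ k × 2 * k ≤ k * (q ∸ 1) + 4
  composite k≢2 ¬odd zero k≡qd = contradiction k≡qd (m<n⇒n≢0 2≤k)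
  composite k≢2 ¬odd 1 k≡qd = contradiction
    (least-divisor≡k⇒prime d≡k , λ 2∣k → k≢2 (≤-antisym (subst (_≤ 2) d≡k (proj₂ least 2 (≤-refl , 2∣k))) 2≤k)) ¬odd
    where
    d≡k : d ≡ k
    d≡k = sym (trans k≡qd (+-identityʳ d))
  composite k≢2 ¬odd 2 refl with refl ← ≤-antisym (proj₂ least 2 (≤-refl , divides d (*-comm 2 d))) 1<d =
    ≤-refl , ≤-refl
  composite k≢2 ¬odd (suc (suc (suc q))) refl =
    *-mono-≤ {2} {3 + q} (s≤s (s≤s z≤n)) 1<d ,
    ≤-trans (≤-trans (≤-reflexive (*-comm 2 k)) (*-monoʳ-≤ k (s≤s (s≤s z≤n)))) (m≤m+n _ 4)

theorem1 : (k : ℕ) → 2 ≤ k →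
    (G : D0L 2) → axiomWord G ≡ [ a ] → Uniform G k → Circular G →
    (d : ℕ) → .{{_ : NonZero d}} → IsLeastDivisor>1 k d →
    (Zmin : ℕ) → IsMinimalSynchronizingDelay G Zmin →
    (k ≡ 2 → Zmin ≤ 8)
    × (OddPrime k → Zmin ≤ (k ^ 2 + 3 * k) ∸ 4)
    × (k ≢ 2 → ¬ OddPrime k → Zmin ≤ (k ^ 2 * (k / d ∸ 1) + 5 * k) ∸ 4)
theorem1 k 2≤k G axiom≡a uniform circular d least Zmin (delay , minimal) = two , odd-prime , otherwise
  where
  instance
    k≢0 : NonZero k
    k≢0 = >-nonZero (<⇒≤ 2≤k)
  open System k 2≤k G axiom≡a uniform using (Long; module Injective)
  open Injective (Circular.injective circular) using (long⇒delay)
  open LeastDivisor 2≤k least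

  Zmin≤ : ∀ {T B} → Long T → 1 ≤ B × T * k ≤ suc B → Zmin ≤ B
  Zmin≤ {B = B} long (1≤B , Tk≤) = minimal B (long⇒delay delay long 1≤B Tk≤)

  two : k ≡ 2 → Zmin ≤ 8
  -- Here T = k + 2 = 4, and T k = 8 is at most 9.
  two k≡2 = Zmin≤ {4} (inj₁ (subst Prime (sym k≡2) prime[2] , ≤-reflexive (cong (2 +_) k≡2)))
    (s≤s z≤n , ≤-trans (≤-reflexive (cong (4 *_) k≡2)) (n≤1+n 8))

  odd-prime : OddPrime k → Zmin ≤ k ^ 2 + 3 * k ∸ 4
  odd-prime (k-prime , 2∤k) = Zmin≤ (inj₁ (k-prime , ≤-refl))
    (odd-prime-arithmetic (≤∧≢⇒< 2≤k λ 2≡k → 2∤k (∣-reflexive 2≡k)))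

  k≡ : k ≡ k / d * d
  k≡ = sym (m/n*n≡m (proj₂ (proj₁ least)))

  otherwise : k ≢ 2 → ¬ OddPrime k → Zmin ≤ k ^ 2 * (k / d ∸ 1) + 5 * k ∸ 4
  -- T is k (k / d - 1) + 4, which serves every proper divisor g since g ≤ k / d.
  otherwise k≢2 ¬odd with 4≤k , 2k≤T ← composite k≢2 ¬odd (k / d) k≡ = Zmin≤
    (inj₂ (2k≤T , λ g∣k g<k → +-monoˡ-≤ 4 (*-monoʳ-≤ k (∸-monoˡ-≤ 1 (proper-divisor≤ {k / d} k≡ g∣k g<k)))))
    (composite-arithmetic (k / d ∸ 1) 4≤k)
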